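{- Let $E$ be a finite set and let $\mathcal{Q}\subseteq 2^E$ be a weakly Rayleigh set-system. If $\varnothing\in\mathcal{Q}$ and $E\in\mathcal{Q}$, then $\mathcal{Q}=2^E$.
   Context: For $\omega:2^E\to[0,\infty)$ not identically zero, $Z(\omega;\mathbf{y})=\sum_{S\subseteq E}\omega(S)\prod_{e\in S}y_e$. With $Z_e=\partial Z/\partial y_e$, $Z_{ef}=\partial^2Z/\partial y_e\partial y_f$, $\Delta Z\{e,f\}=Z_eZ_f-Z_{ef}Z$, $Z$ is Rayleigh if $\Delta Z\{e,f\}(\mathbf{y})\ge0$ for all distinct $e,f$ and all $\mathbf{y}$ with all $y_c>0$. $\mathcal{Q}$ is weakly Rayleigh if there is $\omega\ge0$ with $\{S:\omega(S)>0\}=\mathcal{Q}$ and $Z(\omega;\mathbf{y})$ Rayleigh. -}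

module Defs where

open import Data.Bool.Base using (if_then_else_)
open import Data.Fin.Base using (Fin; zero; suc)
open import Data.Fin.Properties using (_≟_)
open import Data.Fin.Subset using (Subset; inside; outside)
open import Data.Nat.Base as ℕ using (ℕ; _⊔_)
import Data.Nat.Properties as ℕ
open import Data.Product.Base using (∃; _×_; _,_)
open import Data.Rational.Base as ℚ using (ℚ; 0ℚ; 1ℚ; ½; ∣_∣)
import Data.Rational.Properties as ℚ
open import Data.Rational.Solver using (module +-*-Solver)
open import Data.Vec.Base using ([]; _∷_)
open import Function.Base using (_∘_)
open import Level using (0ℓ)
open import Relation.Binary.PropositionalEquality
  using (_≡_; _≢_; refl; cong)
open import Relation.Nullary using (¬_; does)
open import Relation.Unary using (Pred; _≐_)

------------------------------------------------------------------------
-- Real numbers: Cauchy sequences of rationals, with equality given by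
-- the equivalence relation _≈_ below.

IsCauchy : (ℕ → ℚ) → Set
IsCauchy x = ∀ ε → 0ℚ ℚ.< ε →
  ∃ λ N → ∀ m n → N ℕ.≤ m → N ℕ.≤ n → ∣ x m ℚ.- x n ∣ ℚ.< ε

record ℝ : Set where
  constructor mkℝ
  field
    seq    : ℕ → ℚ
    cauchy : IsCauchy seq

open ℝ public

-- Abstract, so that normalising a real number exposes only its sequence.
private abstract
  dist-self : ∀ p → ∣ p ℚ.- p ∣ ≡ 0ℚ
  dist-self p = cong ∣_∣ (ℚ.+-inverseʳ p)

  ½-pos : ∀ {ε} → 0ℚ ℚ.< ε → 0ℚ ℚ.< ½ ℚ.* ε
  ½-pos {ε} 0<ε = ℚ.*-monoʳ-<-pos ½ 0<ε

  ½+½ : ∀ ε → ½ ℚ.* ε ℚ.+ ½ ℚ.* ε ≡ ε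
  ½+½ = solve 1 (λ e → con ½ :* e :+ con ½ :* e := e) refl
    where open +-*-Solver

  const-cauchy : ∀ p → IsCauchy (λ _ → p)
  const-cauchy p ε 0<ε = 0 , λ _ _ _ _ → begin-strict
    ∣ p ℚ.- p ∣ ≡⟨ dist-self p ⟩
    0ℚ          <⟨ 0<ε ⟩
    ε           ∎
    where open ℚ.≤-Reasoning

  +-cauchy : ∀ {x y} → IsCauchy x → IsCauchy y →
             IsCauchy (λ n → x n ℚ.+ y n)
  +-cauchy {x} {y} cx cy ε 0<ε
    with cx (½ ℚ.* ε) (½-pos 0<ε) | cy (½ ℚ.* ε) (½-pos 0<ε)
  ... | M , hx | N , hy = M ⊔ N , λ m n p q → begin-strict
    ∣ (x m ℚ.+ y m) ℚ.- (x n ℚ.+ y n) ∣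
      ≡⟨ cong ∣_∣ (rearrange (x m) (y m) (x n) (y n)) ⟩
    ∣ (x m ℚ.- x n) ℚ.+ (y m ℚ.- y n) ∣
      ≤⟨ ℚ.∣p+q∣≤∣p∣+∣q∣ (x m ℚ.- x n) (y m ℚ.- y n) ⟩
    ∣ x m ℚ.- x n ∣ ℚ.+ ∣ y m ℚ.- y n ∣
      <⟨ ℚ.+-mono-< (hx m n (ℕ.m⊔n≤o⇒m≤o M N p) (ℕ.m⊔n≤o⇒m≤o M N q))
                    (hy m n (ℕ.m⊔n≤o⇒n≤o M N p) (ℕ.m⊔n≤o⇒n≤o M N q)) ⟩
    ½ ℚ.* ε ℚ.+ ½ ℚ.* ε
      ≡⟨ ½+½ ε ⟩
    ε ∎
    where
    open ℚ.≤-Reasoning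
    rearrange : ∀ a b c d →
      (a ℚ.+ b) ℚ.- (c ℚ.+ d) ≡ (a ℚ.- c) ℚ.+ (b ℚ.- d)
    rearrange = solve 4 (λ a b c d →
      (a :+ b) :- (c :+ d) := (a :- c) :+ (b :- d)) refl
      where open +-*-Solver

  neg-cauchy : ∀ {x} → IsCauchy x → IsCauchy (λ n → ℚ.- x n)
  neg-cauchy {x} cx ε 0<ε with cx ε 0<ε
  ... | N , hx = N , λ m n p q → begin-strict
    ∣ ℚ.- x m ℚ.- ℚ.- x n ∣ ≡⟨ cong ∣_∣ (rearrange (x m) (x n)) ⟩
    ∣ ℚ.- (x m ℚ.- x n) ∣   ≡⟨ ℚ.∣-p∣≡∣p∣ (x m ℚ.- x n) ⟩
    ∣ x m ℚ.- x n ∣         <⟨ hx m n p q ⟩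
    ε                       ∎
    where
    open ℚ.≤-Reasoning
    rearrange : ∀ a b → ℚ.- a ℚ.- ℚ.- b ≡ ℚ.- (a ℚ.- b)
    rearrange = solve 2 (λ a b → :- a :- :- b := :- (a :- b)) refl
      where open +-*-Solver

  EventuallyBounded : (ℕ → ℚ) → Set
  EventuallyBounded x =
    ∃ λ B → 0ℚ ℚ.< B × ∃ λ N → ∀ n → N ℕ.≤ n → ∣ x n ∣ ℚ.≤ B

  bounded-by : ∀ {x} → IsCauchy x → ∀ ε → 0ℚ ℚ.< ε → EventuallyBounded x
  bounded-by {x} cx ε 0<ε with cx ε 0<ε
  ... | N , hx =
    ε ℚ.+ ∣ x N ∣ ,
    ℚ.+-mono-<-≤ 0<ε (ℚ.0≤∣p∣ (x N)) ,
    N , λ n p → begin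
      ∣ x n ∣                       ≡⟨ cong ∣_∣ (rearrange (x n) (x N)) ⟩
      ∣ (x n ℚ.- x N) ℚ.+ x N ∣     ≤⟨ ℚ.∣p+q∣≤∣p∣+∣q∣ (x n ℚ.- x N) (x N) ⟩
      ∣ x n ℚ.- x N ∣ ℚ.+ ∣ x N ∣   ≤⟨ ℚ.+-monoˡ-≤ ∣ x N ∣ (ℚ.<⇒≤ (hx n N p ℕ.≤-refl)) ⟩
      ε ℚ.+ ∣ x N ∣                 ∎
    where
    open ℚ.≤-Reasoning
    rearrange : ∀ a b → a ≡ (a ℚ.- b) ℚ.+ b
    rearrange = solve 2 (λ a b → a := (a :- b) :+ b) refl
      where open +-*-Solver

  divide : ∀ C ε → 0ℚ ℚ.< C → 0ℚ ℚ.< ε → ∃ λ δ → 0ℚ ℚ.< δ × C ℚ.* δ ≡ ε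
  divide C ε 0<C 0<ε =
    ℚ.1/ C ℚ.* ε ,
    ℚ.positive⁻¹ (ℚ.1/ C ℚ.* ε) {{ℚ.pos*pos⇒pos (ℚ.1/ C) ε}} ,
    (begin-equality
      C ℚ.* (ℚ.1/ C ℚ.* ε)    ≡⟨ ℚ.*-assoc C (ℚ.1/ C) ε ⟨
      (C ℚ.* ℚ.1/ C) ℚ.* ε    ≡⟨ cong (ℚ._* ε) (ℚ.*-inverseʳ C) ⟩
      1ℚ ℚ.* ε                ≡⟨ ℚ.*-identityˡ ε ⟩
      ε                       ∎)
    where
    open ℚ.≤-Reasoning
    instance
      C-pos : ℚ.Positive C
      C-pos = ℚ.positive 0<C
      C-nonZero : ℚ.NonZero C
      C-nonZero = ℚ.pos⇒nonZero C
      ε-pos : ℚ.Positive ε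
      ε-pos = ℚ.positive 0<ε
      1/C-pos : ℚ.Positive (ℚ.1/ C)
      1/C-pos = ℚ.1/pos⇒pos C

  scale : ∀ {δ} p q {D} → 0ℚ ℚ.< D → ∣ p ∣ ℚ.≤ D → ∣ q ∣ ℚ.< δ →
          ∣ p ℚ.* q ∣ ℚ.< D ℚ.* δ
  scale {δ} p q {D} 0<D p≤D q<δ = begin-strict
    ∣ p ℚ.* q ∣       ≡⟨ ℚ.∣p*q∣≡∣p∣*∣q∣ p q ⟩
    ∣ p ∣ ℚ.* ∣ q ∣   ≤⟨ ℚ.*-monoʳ-≤-nonNeg ∣ q ∣ {{ℚ.∣-∣-nonNeg q}} p≤D ⟩
    D ℚ.* ∣ q ∣       <⟨ ℚ.*-monoʳ-<-pos D {{ℚ.positive 0<D}} q<δ ⟩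
    D ℚ.* δ           ∎
    where open ℚ.≤-Reasoning

  product-close : ∀ {A B δ ε} a b c d →
    0ℚ ℚ.< A → 0ℚ ℚ.< B → (A ℚ.+ B) ℚ.* δ ≡ ε →
    ∣ a ∣ ℚ.≤ A → ∣ d ∣ ℚ.≤ B → ∣ a ℚ.- c ∣ ℚ.< δ → ∣ b ℚ.- d ∣ ℚ.< δ →
    ∣ a ℚ.* b ℚ.- c ℚ.* d ∣ ℚ.< ε
  product-close {A} {B} {δ} {ε} a b c d 0<A 0<B eq a≤A d≤B ac bd = begin-strict
    ∣ a ℚ.* b ℚ.- c ℚ.* d ∣
      ≡⟨ cong ∣_∣ (rearrange a b c d) ⟩
    ∣ a ℚ.* (b ℚ.- d) ℚ.+ d ℚ.* (a ℚ.- c) ∣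
      ≤⟨ ℚ.∣p+q∣≤∣p∣+∣q∣ (a ℚ.* (b ℚ.- d)) (d ℚ.* (a ℚ.- c)) ⟩
    ∣ a ℚ.* (b ℚ.- d) ∣ ℚ.+ ∣ d ℚ.* (a ℚ.- c) ∣
      <⟨ ℚ.+-mono-< (scale a (b ℚ.- d) 0<A a≤A bd) (scale d (a ℚ.- c) 0<B d≤B ac) ⟩
    A ℚ.* δ ℚ.+ B ℚ.* δ
      ≡⟨ ℚ.*-distribʳ-+ δ A B ⟨
    (A ℚ.+ B) ℚ.* δ
      ≡⟨ eq ⟩
    ε ∎
    where
    open ℚ.≤-Reasoning
    rearrange : ∀ a b c d →
      a ℚ.* b ℚ.- c ℚ.* d ≡ a ℚ.* (b ℚ.- d) ℚ.+ d ℚ.* (a ℚ.- c)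
    rearrange = solve 4 (λ a b c d →
      a :* b :- c :* d := a :* (b :- d) :+ d :* (a :- c)) refl
      where open +-*-Solver

  *-cauchy : ∀ {x y} → IsCauchy x → IsCauchy y →
             IsCauchy (λ n → x n ℚ.* y n)
  *-cauchy {x} {y} cx cy ε 0<ε =
    step (bounded-by cx ε 0<ε) (bounded-by cy ε 0<ε)
    where
    Goal : Set
    Goal = ∃ λ N → ∀ m n → N ℕ.≤ m → N ℕ.≤ n →
      ∣ x m ℚ.* y m ℚ.- x n ℚ.* y n ∣ ℚ.< ε

    step : EventuallyBounded x → EventuallyBounded y → Goal
    step (A , 0<A , K , bx) (B , 0<B , L , by) =
      step′ (divide (A ℚ.+ B) ε (ℚ.+-mono-< 0<A 0<B) 0<ε)
      where
      step′ : (∃ λ δ → 0ℚ ℚ.< δ × (A ℚ.+ B) ℚ.* δ ≡ ε) → Goal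
      step′ (δ , 0<δ , eq) with cx δ 0<δ | cy δ 0<δ
      ... | M , hx | N , hy = (K ⊔ L) ⊔ (M ⊔ N) , λ m n p q →
        let p₁ = ℕ.m⊔n≤o⇒m≤o (K ⊔ L) (M ⊔ N) p
            p₂ = ℕ.m⊔n≤o⇒n≤o (K ⊔ L) (M ⊔ N) p
            q₁ = ℕ.m⊔n≤o⇒m≤o (K ⊔ L) (M ⊔ N) q
            q₂ = ℕ.m⊔n≤o⇒n≤o (K ⊔ L) (M ⊔ N) q
        in product-close (x m) (y m) (x n) (y n) 0<A 0<B eq
             (bx m (ℕ.m⊔n≤o⇒m≤o K L p₁)) (by n (ℕ.m⊔n≤o⇒n≤o K L q₁))
             (hx m n (ℕ.m⊔n≤o⇒m≤o M N p₂) (ℕ.m⊔n≤o⇒m≤o M N q₂))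
             (hy m n (ℕ.m⊔n≤o⇒n≤o M N p₂) (ℕ.m⊔n≤o⇒n≤o M N q₂))

fromℚ : ℚ → ℝ
fromℚ p = mkℝ (λ _ → p) (const-cauchy p)

0ℝ 1ℝ : ℝ
0ℝ = fromℚ 0ℚ
1ℝ = fromℚ 1ℚ

infixl 6 _+_ _-_
infixl 7 _*_
infix  8 -_
infix  4 _<_ _≤_ _≈_

-_ : ℝ → ℝ
- x = mkℝ (λ n → ℚ.- seq x n) (neg-cauchy {seq x} (cauchy x))

_+_ _*_ _-_ : ℝ → ℝ → ℝ
x + y = mkℝ (λ n → seq x n ℚ.+ seq y n) (+-cauchy {seq x} {seq y} (cauchy x) (cauchy y))
x * y = mkℝ (λ n → seq x n ℚ.* seq y n) (*-cauchy {seq x} {seq y} (cauchy x) (cauchy y))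
x - y = x + (- y)

-- The strict order carries a rational gap; _≤_ and _≈_ are derived from it.
_<_ _≤_ _≈_ : ℝ → ℝ → Set
x < y = ∃ λ ε → 0ℚ ℚ.< ε × ∃ λ N → ∀ n → N ℕ.≤ n → seq x n ℚ.+ ε ℚ.< seq y n
x ≤ y = ¬ (y < x)
x ≈ y = x ≤ y × y ≤ x

------------------------------------------------------------------------
-- Polynomials in the variables y_e, e ∈ Fin n, as expressions

infixl 6 _⊕_
infixl 7 _⊗_

data Poly (n : ℕ) : Set where
  con : ℝ → Poly n
  var : Fin n → Poly n
  _⊕_ : Poly n → Poly n → Poly n
  _⊗_ : Poly n → Poly n → Poly n

⟦_⟧ : ∀ {n} → Poly n → (Fin n → ℝ) → ℝ
⟦ con c ⟧ y = c
⟦ var e ⟧ y = y e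
⟦ P ⊕ R ⟧ y = ⟦ P ⟧ y + ⟦ R ⟧ y
⟦ P ⊗ R ⟧ y = ⟦ P ⟧ y * ⟦ R ⟧ y

-- ∂ e P is the formal partial derivative of P with respect to y_e.
∂ : ∀ {n} → Fin n → Poly n → Poly n
∂ e (con c) = con 0ℝ
∂ e (var f) = con (if does (e ≟ f) then 1ℝ else 0ℝ)
∂ e (P ⊕ R) = ∂ e P ⊕ ∂ e R
∂ e (P ⊗ R) = (∂ e P ⊗ R) ⊕ (P ⊗ ∂ e R)

-- ∑ m F is the sum of F S over all subsets S of Fin m.
∑ : ∀ {n} m → (Subset m → Poly n) → Poly n
∑ ℕ.zero    F = F []
∑ (ℕ.suc m) F = ∑ m (F ∘ (outside ∷_)) ⊕ ∑ m (F ∘ (inside ∷_))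

-- ∏ S g is the product of g e over all e ∈ S.
∏ : ∀ {m n} → Subset m → (Fin m → Poly n) → Poly n
∏ []            g = con 1ℝ
∏ (outside ∷ S) g = ∏ S (g ∘ suc)
∏ (inside  ∷ S) g = g zero ⊗ ∏ S (g ∘ suc)

------------------------------------------------------------------------
-- Rayleigh polynomials and weakly Rayleigh set-systems on E = Fin n

Z : ∀ {n} → (Subset n → ℝ) → Poly n
Z {n} ω = ∑ n (λ S → con (ω S) ⊗ ∏ S var)

Δ : ∀ {n} → Poly n → Fin n → Fin n → (Fin n → ℝ) → ℝ
Δ P e f y = ⟦ ∂ e P ⟧ y * ⟦ ∂ f P ⟧ y - ⟦ ∂ e (∂ f P) ⟧ y * ⟦ P ⟧ y

IsRayleigh : ∀ {n} → Poly n → Set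
IsRayleigh {n} P = ∀ (e f : Fin n) → e ≢ f →
  ∀ (y : Fin n → ℝ) → (∀ c → 0ℝ < y c) → 0ℝ ≤ Δ P e f y

SetSystem : ℕ → Set₁
SetSystem n = Pred (Subset n) 0ℓ

record IsWeaklyRayleigh {n} (Q : SetSystem n) : Set where
  field
    ω         : Subset n → ℝ
    ω-nonneg  : ∀ S → 0ℝ ≤ ω S
    ω-nonzero : ¬ (∀ S → ω S ≈ 0ℝ)
    support   : (λ S → 0ℝ < ω S) ≐ Q
    rayleigh  : IsRayleigh (Z ω)

{-# OPTIONS --safe #-}
module Submission where

-- Let A ⊆ B be in the support and e, f ∈ B ∖ A distinct.  Split Z into the
-- parts p, q, r, s over the sets containing both, only e, only f, or neither
-- of e and f, evaluated at y_e = y_f = 1; then Δ Z {e,f} = q r − p s.  Giving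
-- the elements of A a large value 1/t, those outside B the small value t and
-- the rest the value 1 makes the sets between A and B dominate.  There p and s
-- contain the terms of B and A, so q r ≥ p s forces q > 0: some S ∋ e in the
-- support has A ⊆ S ⊆ B and f ∉ S.  Induction on B ∖ A, first for (A , S) and
-- then for (A ∪ {e} , B), puts every set between A and B in the support.
--
-- The order on ℝ is not decidable, so the weights on S are compared with an
-- explicit threshold M t: either some ω S is positive, or all are eventually
-- below the threshold, which makes Δ negative by a fixed rational amount.

open import Defs
open import Data.Bool.Base using (Bool; true; false; if_then_else_; _∧_; not)
open import Data.Empty using (⊥-elim)
open import Data.Fin.Base using (Fin; zero; suc)
open import Data.Fin.Properties using (_≟_; suc-injective)
open import Data.Fin.Subset as Subset
  using (Subset; inside; outside; ⊥; ⊤; ⁅_⁆; _⊆_; _∪_; _─_)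
open import Data.Fin.Subset.Induction using (⊂-wellFounded; Acc; acc)
import Data.Fin.Subset.Properties as Subset
open import Data.Nat.Base as ℕ using (ℕ)
import Data.Nat.Properties as ℕ
open import Data.Product.Base using (∃; _×_; _,_; proj₁; proj₂)
open import Data.Rational.Base as ℚ using (ℚ; 0ℚ; 1ℚ; ½; ∣_∣)
import Data.Rational.Properties as ℚ
open import Data.Rational.Solver using (module +-*-Solver)
open import Data.Sum.Base using (_⊎_; inj₁; inj₂)
open import Data.Unit.Base using (tt)
open import Data.Vec.Base using ([]; _∷_; lookup; here; there)
open import Data.Vec.Properties using (lookup⇒[]=; []=⇒lookup)
open import Function.Base using (_∘_; id)
open import Relation.Binary.PropositionalEquality
  using (_≡_; _≢_; refl; sym; trans; cong; cong₂; subst; module ≡-Reasoning)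
open import Relation.Nullary using (¬_; Dec; yes; no; contradiction)
open import Relation.Nullary.Decidable using (_×-dec_; ¬?; decidable-stable)
open import Relation.Unary using (_∈_; _≐_; U)

open +-*-Solver using (solve; _:=_; _:+_; _:*_; _:-_; :-_; con)

private
  variable
    n m : ℕ
    p q r s x y : ℚ

-- Order and absolute value on the rationals.

0≤1 : 0ℚ ℚ.≤ 1ℚ
0≤1 = ℚ.nonNegative⁻¹ 1ℚ

0<½* : 0ℚ ℚ.< p → 0ℚ ℚ.< ½ ℚ.* p
0<½* {p} = ℚ.*-monoʳ-<-pos ½

0≤+ : 0ℚ ℚ.≤ p → 0ℚ ℚ.≤ q → 0ℚ ℚ.≤ p ℚ.+ q
0≤+ = ℚ.+-mono-≤

0≤* : 0ℚ ℚ.≤ p → 0ℚ ℚ.≤ q → 0ℚ ℚ.≤ p ℚ.* q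
0≤* {p} {q} 0≤p 0≤q = ℚ.nonNegative⁻¹ (p ℚ.* q)
  {{ℚ.nonNeg*nonNeg⇒nonNeg p {{ℚ.nonNegative 0≤p}} q {{ℚ.nonNegative 0≤q}}}}

0<* : 0ℚ ℚ.< p → 0ℚ ℚ.< q → 0ℚ ℚ.< p ℚ.* q
0<* {p} {q} 0<p 0<q = ℚ.positive⁻¹ (p ℚ.* q)
  {{ℚ.pos*pos⇒pos p {{ℚ.positive 0<p}} q {{ℚ.positive 0<q}}}}

*-monoˡ : 0ℚ ℚ.≤ r → p ℚ.≤ q → p ℚ.* r ℚ.≤ q ℚ.* r
*-monoˡ {r} 0≤r = ℚ.*-monoʳ-≤-nonNeg r {{ℚ.nonNegative 0≤r}}

*-monoʳ : 0ℚ ℚ.≤ r → p ℚ.≤ q → r ℚ.* p ℚ.≤ r ℚ.* q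
*-monoʳ {r} {p} {q} 0≤r p≤q
  rewrite ℚ.*-comm r p | ℚ.*-comm r q = *-monoˡ 0≤r p≤q

*-mono : 0ℚ ℚ.≤ q → 0ℚ ℚ.≤ r → p ℚ.≤ q → r ℚ.≤ s → p ℚ.* r ℚ.≤ q ℚ.* s
*-mono 0≤q 0≤r p≤q r≤s = ℚ.≤-trans (*-monoˡ 0≤r p≤q) (*-monoʳ 0≤q r≤s)

0≤*-cancel : 0ℚ ℚ.< p → 0ℚ ℚ.≤ p ℚ.* q → 0ℚ ℚ.≤ q
0≤*-cancel {p} {q} 0<p 0≤pq = ℚ.*-cancelˡ-≤-pos p {{ℚ.positive 0<p}}
  (subst (ℚ._≤ p ℚ.* q) (sym (ℚ.*-zeroʳ p)) 0≤pq)

≤-from-difference : ∀ d → 0ℚ ℚ.≤ d → y ≡ x ℚ.+ d → x ℚ.≤ y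
≤-from-difference {y} {x} d 0≤d y≡x+d = begin
  x          ≡⟨ ℚ.+-identityʳ x ⟨
  x ℚ.+ 0ℚ   ≤⟨ ℚ.+-monoʳ-≤ x 0≤d ⟩
  x ℚ.+ d    ≡⟨ y≡x+d ⟨
  y          ∎
  where open ℚ.≤-Reasoning

<⇒0<- : x ℚ.< y → 0ℚ ℚ.< y ℚ.- x
<⇒0<- {x} {y} x<y = subst (ℚ._< y ℚ.- x) (ℚ.+-inverseʳ x) (ℚ.+-monoˡ-< (ℚ.- x) x<y)

p≤∣p∣ : ∀ p → p ℚ.≤ ∣ p ∣
p≤∣p∣ p with ℚ.≤-total 0ℚ p
... | inj₁ 0≤p = ℚ.≤-reflexive (sym (ℚ.0≤p⇒∣p∣≡p 0≤p))
... | inj₂ p≤0 = ℚ.≤-trans p≤0 (ℚ.0≤∣p∣ p)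

-p≤∣p∣ : ∀ p → ℚ.- p ℚ.≤ ∣ p ∣
-p≤∣p∣ p = subst (ℚ.- p ℚ.≤_) (ℚ.∣-p∣≡∣p∣ p) (p≤∣p∣ (ℚ.- p))

∣p∣≤ : ℚ.- q ℚ.≤ p → p ℚ.≤ q → ∣ p ∣ ℚ.≤ q
∣p∣≤ {q} {p} -q≤p p≤q with ℚ.∣p∣≡p∨∣p∣≡-p p
... | inj₁ eq rewrite eq = p≤q
... | inj₂ eq rewrite eq = subst (ℚ.- p ℚ.≤_) (neg-neg q) (ℚ.neg-antimono-≤ -q≤p)
  where
  neg-neg : ∀ q → ℚ.- ℚ.- q ≡ q
  neg-neg = solve 1 (λ q → :- :- q := q) refl

∣-∣<⇒< : ∣ p ℚ.- q ∣ ℚ.< r → p ℚ.< q ℚ.+ r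
∣-∣<⇒< {p} {q} {r} d<r = begin-strict
  p                    ≡⟨ lemma p q ⟩
  q ℚ.+ (p ℚ.- q)      <⟨ ℚ.+-monoʳ-< q (ℚ.≤-<-trans (p≤∣p∣ (p ℚ.- q)) d<r) ⟩
  q ℚ.+ r              ∎
  where
  open ℚ.≤-Reasoning
  lemma : ∀ p q → p ≡ q ℚ.+ (p ℚ.- q)
  lemma = solve 2 (λ p q → p := q :+ (p :- q)) refl

∣-∣<⇒> : ∣ p ℚ.- q ∣ ℚ.< r → q ℚ.- r ℚ.< p
∣-∣<⇒> {p} {q} {r} d<r = begin-strict
  q ℚ.- r                   <⟨ ℚ.+-monoʳ-< q (ℚ.neg-antimono-< (ℚ.≤-<-trans (-p≤∣p∣ (p ℚ.- q)) d<r)) ⟩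
  q ℚ.- ℚ.- (p ℚ.- q)       ≡⟨ lemma p q ⟩
  p                         ∎
  where
  open ℚ.≤-Reasoning
  lemma : ∀ p q → q ℚ.- ℚ.- (p ℚ.- q) ≡ p
  lemma = solve 2 (λ p q → q :- :- (p :- q) := p) refl

divide-by : 0ℚ ℚ.< p → 0ℚ ℚ.< q → ∃ λ t → 0ℚ ℚ.< t × p ℚ.* t ≡ q
divide-by {p} {q} 0<p 0<q =
  ℚ.1/ p ℚ.* q ,
  0<* (ℚ.positive⁻¹ (ℚ.1/ p) {{ℚ.1/pos⇒pos p}}) 0<q ,
  (begin
    p ℚ.* (ℚ.1/ p ℚ.* q)   ≡⟨ ℚ.*-assoc p (ℚ.1/ p) q ⟨
    p ℚ.* ℚ.1/ p ℚ.* q     ≡⟨ cong (ℚ._* q) (ℚ.*-inverseʳ p) ⟩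
    1ℚ ℚ.* q               ≡⟨ ℚ.*-identityˡ q ⟩
    q                      ∎)
  where
  open ≡-Reasoning
  instance
    _ : ℚ.Positive p
    _ = ℚ.positive 0<p
    _ : ℚ.NonZero p
    _ = ℚ.pos⇒nonZero p

-- The choice of t and the estimate for Δ.

-- In units of W², where W is the weight of A: the lower bound (a - ct)² for p s minus the upper
-- bound ct · c for q r. Here a bounds the coefficients of A and B from below, and c is a bound on
-- all coefficients times the number of subsets.
gap : ℚ → ℚ → ℚ → ℚ
gap a c t = (a ℚ.- c ℚ.* t) ℚ.* (a ℚ.- c ℚ.* t) ℚ.- c ℚ.* t ℚ.* c

-- The witness is t = a² / (a² + 4ac + 2c²).
small-scale : ∀ {a c} → 0ℚ ℚ.< a → 0ℚ ℚ.≤ c →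
  ∃ λ t → 0ℚ ℚ.< t × t ℚ.≤ 1ℚ × 0ℚ ℚ.≤ a ℚ.- c ℚ.* t × 0ℚ ℚ.< gap a c t
small-scale {a} {c} 0<a 0≤c =
  step (divide-by {X} (ℚ.+-mono-<-≤ 0<aa 0≤Y) 0<aa)
  where
  aa = a ℚ.* a
  ac = a ℚ.* c
  cc = c ℚ.* c
  Y = (ac ℚ.+ ac ℚ.+ (ac ℚ.+ ac)) ℚ.+ (cc ℚ.+ cc)
  X = aa ℚ.+ Y
  0<aa : 0ℚ ℚ.< aa
  0<aa = 0<* 0<a 0<a
  0≤a : 0ℚ ℚ.≤ a
  0≤a = ℚ.<⇒≤ 0<a
  0≤ac : 0ℚ ℚ.≤ ac
  0≤ac = 0≤* 0≤a 0≤c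
  0≤cc : 0ℚ ℚ.≤ cc
  0≤cc = 0≤* 0≤c 0≤c
  0≤Y : 0ℚ ℚ.≤ Y
  0≤Y = 0≤+ (0≤+ (0≤+ 0≤ac 0≤ac) (0≤+ 0≤ac 0≤ac)) (0≤+ 0≤cc 0≤cc)

  step : (∃ λ t → 0ℚ ℚ.< t × X ℚ.* t ≡ aa) →
    ∃ λ t → 0ℚ ℚ.< t × t ℚ.≤ 1ℚ × 0ℚ ℚ.≤ a ℚ.- c ℚ.* t × 0ℚ ℚ.< gap a c t
  step (t , 0<t , Xt≡aa) =
    t , 0<t ,
    ≤-from-difference (1ℚ ℚ.- t) (0≤*-cancel 0<aa (subst (0ℚ ℚ.≤_) (sym eq₁) (0≤* 0≤Y 0≤t)))
      (1≡t+1-t t) ,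
    0≤*-cancel 0<a (subst (0ℚ ℚ.≤_) (sym eq₂)
      (0≤* (0≤+ (ℚ.<⇒≤ 0<aa) (0≤+ (0≤+ (0≤+ 0≤ac 0≤ac) 0≤ac) (0≤+ 0≤cc 0≤cc))) 0≤t)) ,
    subst (0ℚ ℚ.<_) (sym eq₃)
      (ℚ.+-mono-<-≤ (0<½* 0<aa)
        (0≤+ (ℚ.<⇒≤ (0<½* (0<* 0<aa 0<t))) (0≤* (0≤* 0≤c 0≤t) (0≤* 0≤c 0≤t))))
    where
    open ≡-Reasoning
    0≤t : 0ℚ ℚ.≤ t
    0≤t = ℚ.<⇒≤ 0<t
    1≡t+1-t : ∀ t → 1ℚ ≡ t ℚ.+ (1ℚ ℚ.- t)
    1≡t+1-t = solve 1 (λ t → con 1ℚ := t :+ (con 1ℚ :- t)) refl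
    eq₁ : aa ℚ.* (1ℚ ℚ.- t) ≡ Y ℚ.* t
    eq₁ = begin
      aa ℚ.* (1ℚ ℚ.- t)           ≡⟨ solve 2 (λ u t → u :* (con 1ℚ :- t) := u :- u :* t) refl aa t ⟩
      aa ℚ.- aa ℚ.* t             ≡⟨ cong (ℚ._- aa ℚ.* t) Xt≡aa ⟨
      X ℚ.* t ℚ.- aa ℚ.* t        ≡⟨ solve 3 (λ u v t → (u :+ v) :* t :- u :* t := v :* t) refl aa Y t ⟩
      Y ℚ.* t                     ∎
    eq₂ : a ℚ.* (a ℚ.- c ℚ.* t) ≡
      (aa ℚ.+ ((ac ℚ.+ ac ℚ.+ ac) ℚ.+ (cc ℚ.+ cc))) ℚ.* t
    eq₂ = begin
      a ℚ.* (a ℚ.- c ℚ.* t)       ≡⟨ solve 3 (λ a c t → a :* (a :- c :* t) := a :* a :- a :* c :* t) refl a c t ⟩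
      aa ℚ.- ac ℚ.* t             ≡⟨ cong (ℚ._- ac ℚ.* t) Xt≡aa ⟨
      X ℚ.* t ℚ.- ac ℚ.* t        ≡⟨ solve 4 (λ u v w t →
        (u :+ (v :+ v :+ (v :+ v) :+ (w :+ w))) :* t :- v :* t :=
        (u :+ (v :+ v :+ v :+ (w :+ w))) :* t) refl aa ac cc t ⟩
      _ ∎
    -- The coefficients 4ac and 2c² in `X` are chosen for this identity: trading half of a² for half
    -- of X t cancels the negative terms 2act + c²t exactly.
    eq₃ : gap a c t ≡ ½ ℚ.* aa ℚ.+ (½ ℚ.* (aa ℚ.* t) ℚ.+ (c ℚ.* t) ℚ.* (c ℚ.* t))
    eq₃ = begin
      gap a c t ≡⟨ solve 3 (λ a c t →
          (a :- c :* t) :* (a :- c :* t) :- c :* t :* c :=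
          con ½ :* (a :* a) :+ (con ½ :* (a :* a) :-
            (a :* c :* t :+ a :* c :* t :+ c :* c :* t :- c :* t :* (c :* t)))) refl a c t ⟩
      ½ ℚ.* aa ℚ.+ (½ ℚ.* aa ℚ.- (ac ℚ.* t ℚ.+ ac ℚ.* t ℚ.+ cc ℚ.* t ℚ.- c ℚ.* t ℚ.* (c ℚ.* t)))
        ≡⟨ cong (λ z → ½ ℚ.* aa ℚ.+ (½ ℚ.* z ℚ.- (ac ℚ.* t ℚ.+ ac ℚ.* t ℚ.+ cc ℚ.* t ℚ.- c ℚ.* t ℚ.* (c ℚ.* t)))) Xt≡aa ⟨
      ½ ℚ.* aa ℚ.+ (½ ℚ.* (X ℚ.* t) ℚ.- (ac ℚ.* t ℚ.+ ac ℚ.* t ℚ.+ cc ℚ.* t ℚ.- c ℚ.* t ℚ.* (c ℚ.* t)))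
        ≡⟨ cong (½ ℚ.* aa ℚ.+_) (solve 5 (λ u v w z t →
          con ½ :* ((u :+ (v :+ v :+ (v :+ v) :+ (w :+ w))) :* t) :- (v :* t :+ v :* t :+ w :* t :- z) :=
          con ½ :* (u :* t) :+ z) refl aa ac cc (c ℚ.* t ℚ.* (c ℚ.* t)) t) ⟩
      _ ∎

-- With p, q, r, s the parts of Z over the sets containing both, only the
-- first, only the second, or neither of e and f, the left side is Δ Z {e,f}.
Δ-bound : ∀ {p q r s a c t W} →
  0ℚ ℚ.≤ t → 0ℚ ℚ.≤ c → 0ℚ ℚ.≤ W → 0ℚ ℚ.≤ a ℚ.- c ℚ.* t →
  ∣ q ∣ ℚ.≤ c ℚ.* t ℚ.* W → ∣ r ∣ ℚ.≤ c ℚ.* W →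
  (a ℚ.- c ℚ.* t) ℚ.* W ℚ.≤ p → (a ℚ.- c ℚ.* t) ℚ.* W ℚ.≤ s →
  (p ℚ.+ q) ℚ.* (p ℚ.+ r) ℚ.- p ℚ.* (p ℚ.+ q ℚ.+ (r ℚ.+ s)) ℚ.≤
    ℚ.- (gap a c t ℚ.* (W ℚ.* W))
Δ-bound {p} {q} {r} {s} {a} {c} {t} {W} 0≤t 0≤c 0≤W 0≤b q≤ r≤ ≤p ≤s = begin
  (p ℚ.+ q) ℚ.* (p ℚ.+ r) ℚ.- p ℚ.* (p ℚ.+ q ℚ.+ (r ℚ.+ s))
    ≡⟨ solve 4 (λ p q r s → (p :+ q) :* (p :+ r) :- p :* (p :+ q :+ (r :+ s)) :=
         q :* r :- p :* s) refl p q r s ⟩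
  q ℚ.* r ℚ.- p ℚ.* s
    ≤⟨ ℚ.+-mono-≤ qr≤ (ℚ.neg-antimono-≤ ≤ps) ⟩
  c ℚ.* t ℚ.* W ℚ.* (c ℚ.* W) ℚ.- b ℚ.* W ℚ.* (b ℚ.* W)
    ≡⟨ solve 4 (λ d c b W → d :* W :* (c :* W) :- b :* W :* (b :* W) :=
         :- ((b :* b :- d :* c) :* (W :* W))) refl (c ℚ.* t) c b W ⟩
  ℚ.- (gap a c t ℚ.* (W ℚ.* W)) ∎
  where
  open ℚ.≤-Reasoning
  b = a ℚ.- c ℚ.* t
  0≤bW : 0ℚ ℚ.≤ b ℚ.* W
  0≤bW = 0≤* 0≤b 0≤W
  ≤ps : b ℚ.* W ℚ.* (b ℚ.* W) ℚ.≤ p ℚ.* s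
  ≤ps = *-mono (ℚ.≤-trans 0≤bW ≤p) 0≤bW ≤p ≤s
  qr≤ : q ℚ.* r ℚ.≤ c ℚ.* t ℚ.* W ℚ.* (c ℚ.* W)
  qr≤ = begin
    q ℚ.* r           ≤⟨ p≤∣p∣ (q ℚ.* r) ⟩
    ∣ q ℚ.* r ∣       ≡⟨ ℚ.∣p*q∣≡∣p∣*∣q∣ q r ⟩
    ∣ q ∣ ℚ.* ∣ r ∣   ≤⟨ *-mono (0≤* (0≤* 0≤c 0≤t) 0≤W) (ℚ.0≤∣p∣ r) q≤ r≤ ⟩
    c ℚ.* t ℚ.* W ℚ.* (c ℚ.* W) ∎

-- Sums and products over subsets.

∑ℚ : ∀ m → (Subset m → ℚ) → ℚ
∑ℚ ℕ.zero    F = F []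
∑ℚ (ℕ.suc m) F = ∑ℚ m (F ∘ (outside ∷_)) ℚ.+ ∑ℚ m (F ∘ (inside ∷_))

#subsets : ℕ → ℚ
#subsets m = ∑ℚ m (λ _ → 1ℚ)

∏ℚ : Subset m → (Fin m → ℚ) → ℚ
∏ℚ []            y = 1ℚ
∏ℚ (outside ∷ S) y = ∏ℚ S (y ∘ suc)
∏ℚ (inside  ∷ S) y = y zero ℚ.* ∏ℚ S (y ∘ suc)

∏ℚ-pos : ∀ (S : Subset m) {y} → (∀ e → 0ℚ ℚ.< y e) → 0ℚ ℚ.< ∏ℚ S y
∏ℚ-pos []            0<y = ℚ.positive⁻¹ 1ℚ
∏ℚ-pos (outside ∷ S) 0<y = ∏ℚ-pos S (0<y ∘ suc)
∏ℚ-pos (inside  ∷ S) 0<y = 0<* (0<y zero) (∏ℚ-pos S (0<y ∘ suc))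

∑ℚ-cong : ∀ {F G : Subset m → ℚ} → (∀ S → F S ≡ G S) → ∑ℚ m F ≡ ∑ℚ m G
∑ℚ-cong {ℕ.zero}  F≡G = F≡G []
∑ℚ-cong {ℕ.suc m} F≡G =
  cong₂ ℚ._+_ (∑ℚ-cong (F≡G ∘ (outside ∷_))) (∑ℚ-cong (F≡G ∘ (inside ∷_)))

∑ℚ-mono : ∀ {F G : Subset m → ℚ} → (∀ S → F S ℚ.≤ G S) → ∑ℚ m F ℚ.≤ ∑ℚ m G
∑ℚ-mono {ℕ.zero}  F≤G = F≤G []
∑ℚ-mono {ℕ.suc m} F≤G =
  ℚ.+-mono-≤ (∑ℚ-mono (F≤G ∘ (outside ∷_))) (∑ℚ-mono (F≤G ∘ (inside ∷_)))

∑ℚ-+ : ∀ (F G : Subset m → ℚ) → ∑ℚ m (λ S → F S ℚ.+ G S) ≡ ∑ℚ m F ℚ.+ ∑ℚ m G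
∑ℚ-+ {ℕ.zero}  F G = refl
∑ℚ-+ {ℕ.suc m} F G = trans
  (cong₂ ℚ._+_ (∑ℚ-+ (F ∘ (outside ∷_)) (G ∘ (outside ∷_))) (∑ℚ-+ (F ∘ (inside ∷_)) (G ∘ (inside ∷_))))
  (solve 4 (λ a b c d → (a :+ b) :+ (c :+ d) := (a :+ c) :+ (b :+ d)) refl
    (∑ℚ m (F ∘ (outside ∷_))) (∑ℚ m (G ∘ (outside ∷_)))
    (∑ℚ m (F ∘ (inside ∷_)))  (∑ℚ m (G ∘ (inside ∷_))))

∑ℚ-const : ∀ m c → ∑ℚ m (λ _ → c) ≡ #subsets m ℚ.* c
∑ℚ-const ℕ.zero    c = sym (ℚ.*-identityˡ c)
∑ℚ-const (ℕ.suc m) c = trans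
  (cong₂ ℚ._+_ (∑ℚ-const m c) (∑ℚ-const m c))
  (sym (ℚ.*-distribʳ-+ c (#subsets m) (#subsets m)))

∑ℚ-∣∣ : ∀ (F : Subset m → ℚ) → ∣ ∑ℚ m F ∣ ℚ.≤ ∑ℚ m (∣_∣ ∘ F)
∑ℚ-∣∣ {ℕ.zero}  F = ℚ.≤-refl
∑ℚ-∣∣ {ℕ.suc m} F = ℚ.≤-trans
  (ℚ.∣p+q∣≤∣p∣+∣q∣ (∑ℚ m (F ∘ (outside ∷_))) (∑ℚ m (F ∘ (inside ∷_))))
  (ℚ.+-mono-≤ (∑ℚ-∣∣ (F ∘ (outside ∷_))) (∑ℚ-∣∣ (F ∘ (inside ∷_))))

∑ℚ-∣∣-≤ : ∀ {c} (F : Subset m → ℚ) → (∀ S → ∣ F S ∣ ℚ.≤ c) →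
          ∣ ∑ℚ m F ∣ ℚ.≤ #subsets m ℚ.* c
∑ℚ-∣∣-≤ {m} {c} F F≤c = begin
  ∣ ∑ℚ m F ∣           ≤⟨ ∑ℚ-∣∣ F ⟩
  ∑ℚ m (∣_∣ ∘ F)       ≤⟨ ∑ℚ-mono F≤c ⟩
  ∑ℚ m (λ _ → c)       ≡⟨ ∑ℚ-const m c ⟩
  #subsets m ℚ.* c     ∎
  where open ℚ.≤-Reasoning

∑ℚ-nonneg : ∀ {F : Subset m → ℚ} → (∀ S → 0ℚ ℚ.≤ F S) → 0ℚ ℚ.≤ ∑ℚ m F
∑ℚ-nonneg {ℕ.zero}  0≤F = 0≤F []
∑ℚ-nonneg {ℕ.suc m} 0≤F = 0≤+ (∑ℚ-nonneg (0≤F ∘ (outside ∷_))) (∑ℚ-nonneg (0≤F ∘ (inside ∷_)))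

term≤∑ℚ : ∀ {F : Subset m → ℚ} → (∀ S → 0ℚ ℚ.≤ F S) → ∀ T → F T ℚ.≤ ∑ℚ m F
term≤∑ℚ         0≤F []            = ℚ.≤-refl
term≤∑ℚ         0≤F (outside ∷ T) = ℚ.≤-trans (term≤∑ℚ (0≤F ∘ (outside ∷_)) T)
  (≤-from-difference _ (∑ℚ-nonneg (0≤F ∘ (inside ∷_))) refl)
term≤∑ℚ {F = F} 0≤F (inside  ∷ T) = ℚ.≤-trans (term≤∑ℚ (0≤F ∘ (inside ∷_)) T)
  (≤-from-difference _ (∑ℚ-nonneg (0≤F ∘ (outside ∷_)))
    (ℚ.+-comm (∑ℚ _ (F ∘ (outside ∷_))) (∑ℚ _ (F ∘ (inside ∷_)))))

-- Raising every term by L makes all of them nonnegative, so a single term is below the raised sum.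
-- The slack L is there because approximations of a nonnegative real may be slightly negative.
∑ℚ-lower : ∀ {L} (F : Subset m → ℚ) → 0ℚ ℚ.≤ L → (∀ S → ℚ.- L ℚ.≤ F S) →
           ∀ T → F T ℚ.- #subsets m ℚ.* L ℚ.≤ ∑ℚ m F
∑ℚ-lower {m} {L} F 0≤L -L≤F T = begin
  F T ℚ.- N ℚ.* L
    ≤⟨ ℚ.+-monoˡ-≤ (ℚ.- (N ℚ.* L)) (≤-from-difference {x = F T} L 0≤L refl) ⟩
  F T ℚ.+ L ℚ.- N ℚ.* L
    ≤⟨ ℚ.+-monoˡ-≤ (ℚ.- (N ℚ.* L)) (term≤∑ℚ {F = λ S → F S ℚ.+ L} 0≤F+L T) ⟩
  ∑ℚ m (λ S → F S ℚ.+ L) ℚ.- N ℚ.* L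
    ≡⟨ cong (ℚ._- N ℚ.* L) (trans (∑ℚ-+ F (λ _ → L)) (cong (∑ℚ m F ℚ.+_) (∑ℚ-const m L))) ⟩
  ∑ℚ m F ℚ.+ N ℚ.* L ℚ.- N ℚ.* L
    ≡⟨ solve 2 (λ f l → f :+ l :- l := f) refl (∑ℚ m F) (N ℚ.* L) ⟩
  ∑ℚ m F ∎
  where
  open ℚ.≤-Reasoning
  N = #subsets m
  0≤F+L : ∀ S → 0ℚ ℚ.≤ F S ℚ.+ L
  0≤F+L S = subst (ℚ._≤ F S ℚ.+ L) (ℚ.+-inverseˡ L) (ℚ.+-monoˡ-≤ L (-L≤F S))

-- Derivatives of Z at a rational point.

indicator : Bool → ℚ
indicator b = if b then 1ℚ else 0ℚ

-- The left side is what the product rule yields for one summand of `Z`; the factor 0 is the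
-- derivative of its constant coefficient.
indicator-* : ∀ p b v w → 0ℚ ℚ.* p ℚ.+ v ℚ.* (indicator b ℚ.* w) ≡ (if b then v ℚ.* w else 0ℚ)
indicator-* p true  v w = solve 3 (λ p v w → con 0ℚ :* p :+ v :* (con 1ℚ :* w) := v :* w) refl p v w
indicator-* p false v w = solve 3 (λ p v w → con 0ℚ :* p :+ v :* (con 0ℚ :* w) := con 0ℚ) refl p v w

indicator-∧ : ∀ a b → indicator a ℚ.* indicator b ≡ indicator (a ∧ b)
indicator-∧ true  true  = refl
indicator-∧ true  false = refl
indicator-∧ false true  = refl
indicator-∧ false false = refl

both first second neither : Fin m → Fin m → Subset m → Bool
both    e f S = lookup S e ∧ lookup S f
first   e f S = lookup S e ∧ not (lookup S f)
second  e f S = not (lookup S e) ∧ lookup S f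
neither e f S = not (lookup S e) ∧ not (lookup S f)

-- Real operations act termwise on sequences and only rational points are substituted, so at a fixed
-- index `k` every identity about Z is an exact identity of rationals.
module Evaluation {n} (y : Fin n → ℚ) (k : ℕ) where
  open ≡-Reasoning

  eval : Poly n → ℚ
  eval P = seq (⟦ P ⟧ (fromℚ ∘ y)) k

  eval-∑ : ∀ m (F : Subset m → Poly n) → eval (∑ m F) ≡ ∑ℚ m (eval ∘ F)
  eval-∑ ℕ.zero    F = refl
  eval-∑ (ℕ.suc m) F = cong₂ ℚ._+_ (eval-∑ m (F ∘ (outside ∷_))) (eval-∑ m (F ∘ (inside ∷_)))

  eval-∂-∑ : ∀ e m (F : Subset m → Poly n) → eval (∂ e (∑ m F)) ≡ ∑ℚ m (eval ∘ ∂ e ∘ F)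
  eval-∂-∑ e ℕ.zero    F = refl
  eval-∂-∑ e (ℕ.suc m) F = cong₂ ℚ._+_ (eval-∂-∑ e m (F ∘ (outside ∷_))) (eval-∂-∑ e m (F ∘ (inside ∷_)))

  eval-∂∂-∑ : ∀ e f m (F : Subset m → Poly n) →
              eval (∂ e (∂ f (∑ m F))) ≡ ∑ℚ m (eval ∘ ∂ e ∘ ∂ f ∘ F)
  eval-∂∂-∑ e f ℕ.zero    F = refl
  eval-∂∂-∑ e f (ℕ.suc m) F = cong₂ ℚ._+_ (eval-∂∂-∑ e f m (F ∘ (outside ∷_))) (eval-∂∂-∑ e f m (F ∘ (inside ∷_)))

  eval-∏ : ∀ (S : Subset m) (h : Fin m → Fin n) → eval (∏ S (var ∘ h)) ≡ ∏ℚ S (y ∘ h)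
  eval-∏ []            h = refl
  eval-∏ (outside ∷ S) h = eval-∏ S (h ∘ suc)
  eval-∏ (inside  ∷ S) h = cong (y (h zero) ℚ.*_) (eval-∏ S (h ∘ suc))

  δ : Fin n → Fin n → ℚ
  δ e f = eval (∂ e (var f))

  -- The exponent of y_e in the product of the y_(h i) over i ∈ S. The reindexing `h` is needed
  -- because `∏` composes with `suc` at each step of its recursion.
  degree : Fin n → Subset m → (Fin m → Fin n) → ℚ
  degree e []            h = 0ℚ
  degree e (outside ∷ S) h = degree e S (h ∘ suc)
  degree e (inside  ∷ S) h = δ e (h zero) ℚ.+ degree e S (h ∘ suc)

  -- The factor y_f can be inserted freely: `δ e f` vanishes unless f is e, and there y is 1.
  δ-* : ∀ {e} → y e ≡ 1ℚ → ∀ f → δ e f ≡ δ e f ℚ.* y f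
  δ-* {e} ye≡1 f with e ≟ f
  ... | yes refl = trans (sym (ℚ.*-identityˡ 1ℚ)) (cong (1ℚ ℚ.*_) (sym ye≡1))
  ... | no  _    = sym (ℚ.*-zeroˡ (y f))

  δ-orthogonal : ∀ {e f} → e ≢ f → ∀ g → δ e g ℚ.* δ f g ≡ 0ℚ
  δ-orthogonal {e} {f} e≢f g with e ≟ g | f ≟ g
  ... | yes refl | yes refl = contradiction refl e≢f
  ... | yes _    | no  _    = refl
  ... | no  _    | yes _    = refl
  ... | no  _    | no  _    = refl

  -- Euler's relation for the variable y_e, where the factor y_e is 1.
  eval-∂-∏ : ∀ {e} → y e ≡ 1ℚ → ∀ (S : Subset m) (h : Fin m → Fin n) →
             eval (∂ e (∏ S (var ∘ h))) ≡ degree e S h ℚ.* ∏ℚ S (y ∘ h)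
  eval-∂-∏ ye≡1 []            h = refl
  eval-∂-∏ ye≡1 (outside ∷ S) h = eval-∂-∏ ye≡1 S (h ∘ suc)
  eval-∂-∏ {e = e} ye≡1 (inside ∷ S) h = begin
    δ e (h zero) ℚ.* eval (∏ S (var ∘ h ∘ suc)) ℚ.+ v ℚ.* eval (∂ e (∏ S (var ∘ h ∘ suc)))
      ≡⟨ cong₂ (λ a b → a ℚ.+ v ℚ.* b) (cong₂ ℚ._*_ (δ-* ye≡1 (h zero)) (eval-∏ S (h ∘ suc))) (eval-∂-∏ ye≡1 S (h ∘ suc)) ⟩
    d ℚ.* v ℚ.* w ℚ.+ v ℚ.* (c ℚ.* w)
      ≡⟨ solve 4 (λ d v w c → d :* v :* w :+ v :* (c :* w) := (d :+ c) :* (v :* w)) refl d v w c ⟩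
    (d ℚ.+ c) ℚ.* (v ℚ.* w) ∎
    where
    d = δ e (h zero)
    v = y (h zero)
    w = ∏ℚ S (y ∘ h ∘ suc)
    c = degree e S (h ∘ suc)

  -- Euler's relation in two different variables: differentiating in one leaves the exponent of the
  -- other unchanged, so the exponents multiply.
  eval-∂∂-∏ : ∀ {e f} → e ≢ f → y e ≡ 1ℚ → y f ≡ 1ℚ → ∀ (S : Subset m) (h : Fin m → Fin n) →
    eval (∂ e (∂ f (∏ S (var ∘ h)))) ≡ degree e S h ℚ.* degree f S h ℚ.* ∏ℚ S (y ∘ h)
  eval-∂∂-∏ e≢f ye≡1 yf≡1 []            h = refl
  eval-∂∂-∏ e≢f ye≡1 yf≡1 (outside ∷ S) h = eval-∂∂-∏ e≢f ye≡1 yf≡1 S (h ∘ suc)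
  eval-∂∂-∏ {e = e} {f} e≢f ye≡1 yf≡1 (inside ∷ S) h = begin
    0ℚ ℚ.* eval R ℚ.+ df ℚ.* eval (∂ e R) ℚ.+ (de ℚ.* eval (∂ f R) ℚ.+ v ℚ.* eval (∂ e (∂ f R)))
      -- The vanishing second derivative of a single variable is replaced by `de * df * (v * w)`,
      -- zero by orthogonality, which is the term missing from the factorisation into (de + ce)(df +
      -- cf).
      ≡⟨ cong (λ a → a ℚ.+ df ℚ.* eval (∂ e R) ℚ.+ (de ℚ.* eval (∂ f R) ℚ.+ v ℚ.* eval (∂ e (∂ f R))))
           (trans (ℚ.*-zeroˡ (eval R)) (sym (trans (cong (ℚ._* (v ℚ.* w)) (δ-orthogonal e≢f (h zero))) (ℚ.*-zeroˡ (v ℚ.* w))))) ⟩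
    de ℚ.* df ℚ.* (v ℚ.* w) ℚ.+ df ℚ.* eval (∂ e R) ℚ.+ (de ℚ.* eval (∂ f R) ℚ.+ v ℚ.* eval (∂ e (∂ f R)))
      ≡⟨ cong₂ (λ a b → de ℚ.* df ℚ.* (v ℚ.* w) ℚ.+ a ℚ.+ b)
           (cong₂ ℚ._*_ (δ-* yf≡1 (h zero)) (eval-∂-∏ ye≡1 S (h ∘ suc)))
           (cong₂ (λ a b → a ℚ.+ v ℚ.* b)
             (cong₂ ℚ._*_ (δ-* ye≡1 (h zero)) (eval-∂-∏ yf≡1 S (h ∘ suc)))
             (eval-∂∂-∏ e≢f ye≡1 yf≡1 S (h ∘ suc))) ⟩
    de ℚ.* df ℚ.* (v ℚ.* w) ℚ.+ df ℚ.* v ℚ.* (ce ℚ.* w) ℚ.+ (de ℚ.* v ℚ.* (cf ℚ.* w) ℚ.+ v ℚ.* (ce ℚ.* cf ℚ.* w))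
      ≡⟨ solve 6 (λ de df ce cf v w →
           de :* df :* (v :* w) :+ df :* v :* (ce :* w) :+ (de :* v :* (cf :* w) :+ v :* (ce :* cf :* w)) :=
           (de :+ ce) :* (df :+ cf) :* (v :* w)) refl de df ce cf v w ⟩
    (de ℚ.+ ce) ℚ.* (df ℚ.+ cf) ℚ.* (v ℚ.* w) ∎
    where
    R = ∏ S (var ∘ h ∘ suc)
    de = δ e (h zero)
    df = δ f (h zero)
    v = y (h zero)
    w = ∏ℚ S (y ∘ h ∘ suc)
    ce = degree e S (h ∘ suc)
    cf = degree f S (h ∘ suc)

  degree-∉ : ∀ {e} (S : Subset m) (h : Fin m → Fin n) → (∀ i → e ≢ h i) → degree e S h ≡ 0ℚ
  degree-∉ []            h e∉h = refl
  degree-∉ (outside ∷ S) h e∉h = degree-∉ S (h ∘ suc) (e∉h ∘ suc)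
  degree-∉ {e = e} (inside ∷ S) h e∉h with e ≟ h zero
  ... | yes e≡h0 = contradiction e≡h0 (e∉h zero)
  ... | no  _    = trans (ℚ.+-identityˡ _) (degree-∉ S (h ∘ suc) (e∉h ∘ suc))

  -- An injective `h` makes the monomial squarefree, so every exponent is 0 or 1.
  degree-injective : ∀ (S : Subset m) (h : Fin m → Fin n) → (∀ {i j} → h i ≡ h j → i ≡ j) →
                     ∀ i → degree (h i) S h ≡ indicator (lookup S i)
  degree-injective (outside ∷ S) h inj zero    =
    degree-∉ S (h ∘ suc) (λ i eq → contradiction (inj eq) λ ())
  degree-injective (inside  ∷ S) h inj zero    with h zero ≟ h zero
  ... | yes _ = trans (cong (1ℚ ℚ.+_) (degree-∉ S (h ∘ suc) (λ i eq → contradiction (inj eq) λ ()))) (ℚ.+-identityʳ 1ℚ)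
  ... | no h0≢h0 = contradiction refl h0≢h0
  degree-injective (outside ∷ S) h inj (suc i) = degree-injective S (h ∘ suc) (suc-injective ∘ inj) i
  degree-injective (inside  ∷ S) h inj (suc i) with h (suc i) ≟ h zero
  ... | yes eq = contradiction (inj eq) λ ()
  ... | no _ = trans (ℚ.+-identityˡ _) (degree-injective S (h ∘ suc) (suc-injective ∘ inj) i)

  degree-id : ∀ S e → degree e S id ≡ indicator (lookup S e)
  degree-id S = degree-injective S id id

  module _ (ω : Subset n → ℝ) where

    term : Subset n → ℚ
    term S = seq (ω S) k ℚ.* ∏ℚ S y

    restrict : (Subset n → Bool) → Subset n → ℚ
    restrict χ S = if χ S then term S else 0ℚ

    part : (Subset n → Bool) → ℚ
    part χ = ∑ℚ n (restrict χ)

    part-+ : ∀ χ ψ → ∑ℚ n (λ S → restrict χ S ℚ.+ restrict ψ S) ≡ part χ ℚ.+ part ψ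
    part-+ χ ψ = ∑ℚ-+ (restrict χ) (restrict ψ)

    eval-Z : eval (Z ω) ≡ ∑ℚ n term
    eval-Z = trans (eval-∑ n _) (∑ℚ-cong λ S → cong (seq (ω S) k ℚ.*_) (eval-∏ S id))

    eval-∂-Z : ∀ {e} → y e ≡ 1ℚ → eval (∂ e (Z ω)) ≡ part (λ S → lookup S e)
    eval-∂-Z {e} ye≡1 = trans (eval-∂-∑ e n _) (∑ℚ-cong λ S →
      trans (cong (λ z → 0ℚ ℚ.* eval (∏ S var) ℚ.+ seq (ω S) k ℚ.* z)
              (trans (eval-∂-∏ ye≡1 S id) (cong (ℚ._* ∏ℚ S y) (degree-id S e))))
            (indicator-* (eval (∏ S var)) (lookup S e) (seq (ω S) k) (∏ℚ S y)))

    eval-∂∂-Z : ∀ {e f} → e ≢ f → y e ≡ 1ℚ → y f ≡ 1ℚ →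
                eval (∂ e (∂ f (Z ω))) ≡ part (λ S → lookup S e ∧ lookup S f)
    eval-∂∂-Z {e} {f} e≢f ye≡1 yf≡1 = trans (eval-∂∂-∑ e f n _) (∑ℚ-cong λ S →
      trans (cong₂ (λ a b → a ℚ.+ (0ℚ ℚ.* eval (∂ f (∏ S var)) ℚ.+ seq (ω S) k ℚ.* b))
              (solve 2 (λ a b → con 0ℚ :* a :+ con 0ℚ :* b := con 0ℚ) refl (eval (∏ S var)) (eval (∂ e (∏ S var))))
              (trans (eval-∂∂-∏ e≢f ye≡1 yf≡1 S id) (cong (ℚ._* ∏ℚ S y)
                (trans (cong₂ ℚ._*_ (degree-id S e) (degree-id S f)) (indicator-∧ (lookup S e) (lookup S f))))))
            (trans (ℚ.+-identityˡ _) (indicator-* (eval (∂ f (∏ S var))) (lookup S e ∧ lookup S f) (seq (ω S) k) (∏ℚ S y))))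

    -- Since y_e = y_f = 1, removing these factors changes no monomial's value. Hence Z_e, Z_f, Z_ef
    -- and Z are the sums of the parts of Z over the sets containing e, containing f, containing
    -- both, and over all sets.
    Δ-parts : ∀ {e f} → e ≢ f → y e ≡ 1ℚ → y f ≡ 1ℚ →
      let p = part (both e f); q = part (first e f); r = part (second e f); s = part (neither e f) in
      seq (Δ (Z ω) e f (fromℚ ∘ y)) k ≡
        (p ℚ.+ q) ℚ.* (p ℚ.+ r) ℚ.- p ℚ.* (p ℚ.+ q ℚ.+ (r ℚ.+ s))
    Δ-parts {e} {f} e≢f ye≡1 yf≡1 = cong₂ ℚ._-_
      (cong₂ ℚ._*_
        (trans (eval-∂-Z ye≡1) (trans (∑ℚ-cong λ S → with-e (lookup S e) (lookup S f)) (part-+ P Q)))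
        (trans (eval-∂-Z yf≡1) (trans (∑ℚ-cong λ S → with-f (lookup S e) (lookup S f)) (part-+ P R))))
      (cong₂ ℚ._*_ (eval-∂∂-Z e≢f ye≡1 yf≡1)
        (trans eval-Z (trans (∑ℚ-cong λ S → all (lookup S e) (lookup S f))
          (trans (∑ℚ-+ (λ S → restrict P S ℚ.+ restrict Q S) (λ S → restrict R S ℚ.+ restrict T S))
            (cong₂ ℚ._+_ (part-+ P Q) (part-+ R T))))))
      where
      P = both e f
      Q = first e f
      R = second e f
      T = neither e f
      with-e : ∀ a b {z} → (if a then z else 0ℚ) ≡
        (if a ∧ b then z else 0ℚ) ℚ.+ (if a ∧ not b then z else 0ℚ)
      with-e true  true  = sym (ℚ.+-identityʳ _)
      with-e true  false = sym (ℚ.+-identityˡ _)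
      with-e false b     = refl
      with-f : ∀ a b {z} → (if b then z else 0ℚ) ≡
        (if a ∧ b then z else 0ℚ) ℚ.+ (if not a ∧ b then z else 0ℚ)
      with-f true  true  = sym (ℚ.+-identityʳ _)
      with-f false true  = sym (ℚ.+-identityˡ _)
      with-f true  false = refl
      with-f false false = refl
      all : ∀ a b {z} → z ≡
        ((if a ∧ b then z else 0ℚ) ℚ.+ (if a ∧ not b then z else 0ℚ)) ℚ.+
        ((if not a ∧ b then z else 0ℚ) ℚ.+ (if not a ∧ not b then z else 0ℚ))
      all true  true  = sym (trans (ℚ.+-identityʳ _) (ℚ.+-identityʳ _))
      all true  false = sym (trans (ℚ.+-identityʳ _) (ℚ.+-identityˡ _))
      all false true  = sym (trans (ℚ.+-identityˡ _) (ℚ.+-identityʳ _))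
      all false false = sym (trans (ℚ.+-identityˡ _) (ℚ.+-identityˡ _))

-- Subsets and the induction over intervals.

∉⇒lookup : ∀ {S : Subset n} {e} → e Subset.∉ S → lookup S e ≡ false
∉⇒lookup {S = S} {e} e∉S with lookup S e in eq
... | true  = contradiction (lookup⇒[]= e S eq) e∉S
... | false = refl

lookup⇒∉ : ∀ {S : Subset n} {e} → lookup S e ≡ false → e Subset.∉ S
lookup⇒∉ eq e∈S with () ← trans (sym eq) ([]=⇒lookup e∈S)

x∈p─q⇒x∉q : ∀ {P Q : Subset n} {e} → e Subset.∈ P ─ Q → e Subset.∉ Q
x∈p─q⇒x∉q {P = _ ∷ P} {inside ∷ Q}  (there e∈) (there e∈Q) = x∈p─q⇒x∉q e∈ e∈Q
x∈p─q⇒x∉q {P = _ ∷ P} {outside ∷ Q} (there e∈) (there e∈Q) = x∈p─q⇒x∉q e∈ e∈Q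

─-empty⇒⊆ : ∀ (P Q : Subset n) → ¬ Subset.Nonempty (P ─ Q) → P ⊆ Q
─-empty⇒⊆ P Q empty {e} e∈P = decidable-stable (e Subset.∈? Q) λ e∉Q →
  empty (e , Subset.x∈p∧x∉q⇒x∈p─q e∈P e∉Q)

-- The one consequence of the Rayleigh condition that the induction needs, stated for any family of
-- sets so that the induction is purely combinatorial.
Separating : (Subset n → Set) → Set
Separating P = ∀ {A B e f} → A ⊆ B → P A → P B →
  e Subset.∈ B → e Subset.∉ A → f Subset.∈ B → f Subset.∉ A → e ≢ f →
  ∃ λ S → P S × e Subset.∈ S × f Subset.∉ S × A ⊆ S × S ⊆ B

module _ {n} {P : Subset n → Set} (separate : Separating P) where

  -- If T is neither end, pick e in `T ─ A` and f in `B ─ T`. Separation gives S containing e but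
  -- not f; as f is lost, `S ─ A` is smaller than `B ─ A`, and induction below S yields `A ∪ ⁅ e ⁆`.
  -- This set is still inside T because e ∈ T, and it replaces A in the second recursive call.
  interval : ∀ (A B : Subset n) → Acc Subset._⊂_ (B ─ A) → A ⊆ B → P A → P B →
             ∀ T → A ⊆ T → T ⊆ B → P T
  interval A B (acc rec) A⊆B P-A P-B T A⊆T T⊆B
    with Subset.nonempty? (T ─ A) | Subset.nonempty? (B ─ T)
  ... | no T─A-empty | _ =
    subst P (Subset.⊆-antisym A⊆T (─-empty⇒⊆ T A T─A-empty)) P-A
  ... | yes _ | no B─T-empty =
    subst P (Subset.⊆-antisym (─-empty⇒⊆ B T B─T-empty) T⊆B) P-B
  ... | yes (e , e∈T─A) | yes (f , f∈B─T)
    with separate A⊆B P-A P-B (T⊆B e∈T) e∉A f∈B (f∉T ∘ A⊆T) (λ { refl → f∉T e∈T })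
    where
    e∈T = Subset.p─q⊆p T A e∈T─A
    e∉A = x∈p─q⇒x∉q e∈T─A
    f∈B = Subset.p─q⊆p B T f∈B─T
    f∉T = x∈p─q⇒x∉q {Q = T} f∈B─T
  ... | S , P-S , e∈S , f∉S , A⊆S , S⊆B =
    interval C B (rec B─C⊂B─A) (T⊆B ∘ C⊆T) P-C P-B T C⊆T T⊆B
    where
    C = A ∪ ⁅ e ⁆
    e∈C : e Subset.∈ C
    e∈C = Subset.q⊆p∪q A ⁅ e ⁆ (Subset.x∈⁅x⁆ e)
    A⊆C : A ⊆ C
    A⊆C = Subset.p⊆p∪q ⁅ e ⁆
    e∈T = Subset.p─q⊆p T A e∈T─A
    e∉A = x∈p─q⇒x∉q e∈T─A
    f∈B = Subset.p─q⊆p B T f∈B─T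
    f∉T = x∈p─q⇒x∉q {Q = T} f∈B─T

    C-least : ∀ {D : Subset n} → A ⊆ D → e Subset.∈ D → C ⊆ D
    C-least A⊆D e∈D x∈C with Subset.x∈p∪q⁻ A ⁅ e ⁆ x∈C
    ... | inj₁ x∈A = A⊆D x∈A
    ... | inj₂ x∈e rewrite Subset.x∈⁅y⁆⇒x≡y e x∈e = e∈D
    C⊆T : C ⊆ T
    C⊆T = C-least A⊆T e∈T

    S─A⊂B─A : (S ─ A) Subset.⊂ (B ─ A)
    S─A⊂B─A =
      (λ x∈ → Subset.x∈p∧x∉q⇒x∈p─q (S⊆B (Subset.p─q⊆p S A x∈)) (x∈p─q⇒x∉q {Q = A} x∈)) ,
      f , Subset.x∈p∧x∉q⇒x∈p─q f∈B (f∉T ∘ A⊆T) , f∉S ∘ Subset.p─q⊆p S A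
    B─C⊂B─A : (B ─ C) Subset.⊂ (B ─ A)
    B─C⊂B─A =
      (λ x∈ → Subset.x∈p∧x∉q⇒x∈p─q (Subset.p─q⊆p B C x∈) (x∈p─q⇒x∉q {Q = C} x∈ ∘ A⊆C)) ,
      e , Subset.x∈p∧x∉q⇒x∈p─q (T⊆B e∈T) e∉A , λ e∈ → x∈p─q⇒x∉q {Q = C} e∈ e∈C

    P-C : P C
    P-C = interval A S (rec S─A⊂B─A) A⊆S P-A P-S C A⊆C (C-least A⊆S e∈S)

-- Eventual rational bounds for real numbers.

Eventually : (ℕ → Set) → Set
Eventually R = ∃ λ N → ∀ k → N ℕ.≤ k → R k

eventually-× : ∀ {R R′ : ℕ → Set} → Eventually R → Eventually R′ → Eventually (λ k → R k × R′ k)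
eventually-× (M , f) (N , g) = M ℕ.⊔ N , λ k ≤k →
  f k (ℕ.m⊔n≤o⇒m≤o M N ≤k) , g k (ℕ.m⊔n≤o⇒n≤o M N ≤k)

eventually-map : ∀ {R R′ : ℕ → Set} → (∀ {k} → R k → R′ k) → Eventually R → Eventually R′
eventually-map f (N , g) = N , λ k ≤k → f (g k ≤k)

eventually-∀ : ∀ {R : Subset m → ℕ → Set} → (∀ S → Eventually (R S)) → Eventually (λ k → ∀ S → R S k)
eventually-∀ {ℕ.zero}  h = eventually-map (λ { r [] → r }) (h [])
eventually-∀ {ℕ.suc m} h = eventually-map (λ { (r , r′) (outside ∷ S) → r S ; (r , r′) (inside ∷ S) → r′ S })
  (eventually-× (eventually-∀ (h ∘ (outside ∷_))) (eventually-∀ (h ∘ (inside ∷_))))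

-- A finite search in place of excluded middle; the two alternatives may overlap.
∃⊎∀ : ∀ {P R : Subset m → Set} → (∀ S → P S ⊎ R S) → ∃ P ⊎ (∀ S → R S)
∃⊎∀ {ℕ.zero} h with h []
... | inj₁ p = inj₁ ([] , p)
... | inj₂ r = inj₂ λ { [] → r }
∃⊎∀ {ℕ.suc m} h with ∃⊎∀ (h ∘ (outside ∷_)) | ∃⊎∀ (h ∘ (inside ∷_))
... | inj₁ (S , p) | _            = inj₁ (outside ∷ S , p)
... | inj₂ _       | inj₁ (S , p) = inj₁ (inside ∷ S , p)
... | inj₂ r       | inj₂ r′      = inj₂ λ { (outside ∷ S) → r S ; (inside ∷ S) → r′ S }

bounded : ∀ u → ∃ λ B → 0ℚ ℚ.< B × Eventually (λ k → ∣ seq u k ∣ ℚ.≤ B)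
bounded u with cauchy u 1ℚ (ℚ.positive⁻¹ 1ℚ)
... | N , close = 1ℚ ℚ.+ ∣ seq u N ∣ , ℚ.+-mono-<-≤ (ℚ.positive⁻¹ 1ℚ) (ℚ.0≤∣p∣ (seq u N)) , N , λ k ≤k → begin
  ∣ seq u k ∣
    ≡⟨ cong ∣_∣ (solve 2 (λ a b → a := (a :- b) :+ b) refl (seq u k) (seq u N)) ⟩
  ∣ (seq u k ℚ.- seq u N) ℚ.+ seq u N ∣
    ≤⟨ ℚ.∣p+q∣≤∣p∣+∣q∣ (seq u k ℚ.- seq u N) (seq u N) ⟩
  ∣ seq u k ℚ.- seq u N ∣ ℚ.+ ∣ seq u N ∣
    ≤⟨ ℚ.+-monoˡ-≤ ∣ seq u N ∣ (ℚ.<⇒≤ (close k N ≤k ℕ.≤-refl)) ⟩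
  1ℚ ℚ.+ ∣ seq u N ∣ ∎
  where open ℚ.≤-Reasoning

0<⇒eventually : ∀ {u} → 0ℝ < u → ∃ λ a → 0ℚ ℚ.< a × Eventually (λ k → a ℚ.≤ seq u k)
0<⇒eventually (ε , 0<ε , N , h) = ε , 0<ε , N , λ k ≤k →
  ℚ.≤-trans (ℚ.≤-reflexive (sym (ℚ.+-identityˡ ε))) (ℚ.<⇒≤ (h k ≤k))

½+½ : ∀ p → ½ ℚ.* p ℚ.+ ½ ℚ.* p ≡ p
½+½ = solve 1 (λ p → con ½ :* p :+ con ½ :* p := p) refl

-- All terms from N on are within δ/2 of `seq u N`. If that term is below -δ/2, the later ones stay
-- below 0 by the fixed gap `ε`, contradicting 0 ≤ u.
0≤⇒eventually : ∀ {u} → 0ℝ ≤ u → ∀ δ → 0ℚ ℚ.< δ → Eventually (λ k → ℚ.- δ ℚ.≤ seq u k)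
0≤⇒eventually {u} 0≤u δ 0<δ with cauchy u (½ ℚ.* δ) (0<½* 0<δ)
... | N , close with ℚ.- (½ ℚ.* δ) ℚ.≤? seq u N
...   | yes h≤uN = N , λ k ≤k → begin
  ℚ.- δ                                 ≡⟨ cong ℚ.-_ (½+½ δ) ⟨
  ℚ.- (½ ℚ.* δ ℚ.+ ½ ℚ.* δ)             ≡⟨ ℚ.neg-distrib-+ (½ ℚ.* δ) (½ ℚ.* δ) ⟩
  ℚ.- (½ ℚ.* δ) ℚ.- ½ ℚ.* δ             ≤⟨ ℚ.+-monoˡ-≤ _ h≤uN ⟩
  seq u N ℚ.- ½ ℚ.* δ                   ≤⟨ ℚ.<⇒≤ (∣-∣<⇒> (close k N ≤k ℕ.≤-refl)) ⟩
  seq u k                               ∎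
  where open ℚ.≤-Reasoning
...   | no h≰uN = ⊥-elim (0≤u (ε , <⇒0<- (ℚ.≰⇒> h≰uN) , N , λ k ≤k → begin-strict
    seq u k ℚ.+ ε                       <⟨ ℚ.+-monoˡ-< ε (∣-∣<⇒< {seq u k} {seq u N} (close k N ≤k ℕ.≤-refl)) ⟩
    seq u N ℚ.+ ½ ℚ.* δ ℚ.+ ε           ≡⟨ solve 2 (λ a h → a :+ h :+ (:- h :- a) := con 0ℚ) refl (seq u N) (½ ℚ.* δ) ⟩
    0ℚ                                  ∎))
  where
  open ℚ.≤-Reasoning
  ε = ℚ.- (½ ℚ.* δ) ℚ.- seq u N

-- Positivity cannot be decided, but one rational approximation can be compared with δ/2, and its
-- error is also below δ/2.
0<⊎eventually-≤ : ∀ u δ → 0ℚ ℚ.< δ → 0ℝ < u ⊎ Eventually (λ k → seq u k ℚ.≤ δ)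
0<⊎eventually-≤ u δ 0<δ with cauchy u (½ ℚ.* δ) (0<½* 0<δ)
... | N , close with seq u N ℚ.≤? ½ ℚ.* δ
...   | yes uN≤h = inj₂ (N , λ k ≤k → begin
  seq u k                     ≤⟨ ℚ.<⇒≤ (∣-∣<⇒< (close k N ≤k ℕ.≤-refl)) ⟩
  seq u N ℚ.+ ½ ℚ.* δ         ≤⟨ ℚ.+-monoˡ-≤ _ uN≤h ⟩
  ½ ℚ.* δ ℚ.+ ½ ℚ.* δ         ≡⟨ ½+½ δ ⟩
  δ                           ∎)
  where open ℚ.≤-Reasoning
...   | no uN≰h = inj₁ (seq u N ℚ.- ½ ℚ.* δ , <⇒0<- (ℚ.≰⇒> uN≰h) , N , λ k ≤k →
  ℚ.≤-<-trans (ℚ.≤-reflexive (ℚ.+-identityˡ _)) (∣-∣<⇒> (close k N ≤k ℕ.≤-refl)))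

fromℚ-pos : 0ℚ ℚ.< p → 0ℝ < fromℚ p
fromℚ-pos {p} 0<p = ½ ℚ.* p , 0<½* 0<p , 0 , λ _ _ → begin-strict
  0ℚ ℚ.+ ½ ℚ.* p         <⟨ ℚ.+-monoˡ-< (½ ℚ.* p) (0<½* 0<p) ⟩
  ½ ℚ.* p ℚ.+ ½ ℚ.* p    ≡⟨ ½+½ p ⟩
  p                      ∎
  where open ℚ.≤-Reasoning

uniformly-bounded : ∀ (ω : Subset n → ℝ) →
  ∃ λ M → 0ℚ ℚ.< M × Eventually (λ k → ∀ S → ∣ seq (ω S) k ∣ ℚ.≤ M)
uniformly-bounded {n} ω =
  -- The sum of the individual positive bounds serves as their maximum.
  ∑ℚ n bound ,
  ℚ.<-≤-trans (proj₁ (proj₂ (bounded (ω ⊥)))) (bound≤∑ ⊥) ,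
  eventually-map (λ h S → ℚ.≤-trans (h S) (bound≤∑ S))
    (eventually-∀ (λ S → proj₂ (proj₂ (bounded (ω S)))))
  where
  bound : Subset n → ℚ
  bound S = proj₁ (bounded (ω S))
  bound≤∑ : ∀ S → bound S ℚ.≤ ∑ℚ n bound
  bound≤∑ = term≤∑ℚ (λ S → ℚ.<⇒≤ (proj₁ (proj₂ (bounded (ω S)))))

0<⊓ : 0ℚ ℚ.< p → 0ℚ ℚ.< q → 0ℚ ℚ.< p ℚ.⊓ q
0<⊓ {p} {q} 0<p 0<q with ℚ.⊓-sel p q
... | inj₁ eq = subst (0ℚ ℚ.<_) (sym eq) 0<p
... | inj₂ eq = subst (0ℚ ℚ.<_) (sym eq) 0<q

-- Confines the dichotomy to the sets satisfying a decidable `P`; for the others the eventual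
-- statement is vacuous.
guard : ∀ {P X : Set} {R : ℕ → Set} → Dec P → X ⊎ Eventually R → (X × P) ⊎ Eventually (λ k → P → R k)
guard (no ¬p) _        = inj₂ (0 , λ _ _ p → contradiction p ¬p)
guard (yes p) (inj₁ x) = inj₁ (x , p)
guard (yes p) (inj₂ r) = inj₂ (eventually-map (λ r _ → r) r)

-- Weights concentrated on an interval of sets.

-- Up to the common factor ∏ℚ A, letting t → 0 isolates the terms of Z over
-- the sets between A and B.
module Face {t K : ℚ} (0<t : 0ℚ ℚ.< t) (t≤1 : t ℚ.≤ 1ℚ) (0<K : 0ℚ ℚ.< K) (tK≡1 : t ℚ.* K ≡ 1ℚ) where

  weight : Bool → Bool → ℚ
  weight true  _     = K
  weight false true  = 1ℚ
  weight false false = t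

  weights : Subset m → Subset m → Fin m → ℚ
  weights A B e = weight (lookup A e) (lookup B e)

  weights-pos : ∀ (A B : Subset m) e → 0ℚ ℚ.< weights A B e
  weights-pos A B e with lookup A e | lookup B e
  ... | true  | _     = 0<K
  ... | false | true  = ℚ.positive⁻¹ 1ℚ
  ... | false | false = 0<t

  weights-free : ∀ {A B : Subset m} {e} → e Subset.∉ A → e Subset.∈ B → weights A B e ≡ 1ℚ
  weights-free e∉A e∈B rewrite ∉⇒lookup e∉A | []=⇒lookup e∈B = refl

  -- S extends A only by elements of B outside A, and these have weight 1.
  ∏ℚ-face : ∀ (A B S : Subset m) → A ⊆ S → S ⊆ B → ∏ℚ S (weights A B) ≡ ∏ℚ A (weights A B)
  ∏ℚ-face [] [] [] _ _ = refl
  ∏ℚ-face (inside  ∷ A) (_ ∷ B) (inside  ∷ S) A⊆S S⊆B =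
    cong (K ℚ.*_) (∏ℚ-face A B S (Subset.drop-∷-⊆ A⊆S) (Subset.drop-∷-⊆ S⊆B))
  ∏ℚ-face (inside  ∷ A) (_ ∷ B) (outside ∷ S) A⊆S S⊆B with () ← A⊆S here
  ∏ℚ-face (outside ∷ A) (_ ∷ B) (outside ∷ S) A⊆S S⊆B =
    ∏ℚ-face A B S (Subset.drop-∷-⊆ A⊆S) (Subset.drop-∷-⊆ S⊆B)
  ∏ℚ-face (outside ∷ A) (inside  ∷ B) (inside ∷ S) A⊆S S⊆B =
    trans (ℚ.*-identityˡ _) (∏ℚ-face A B S (Subset.drop-∷-⊆ A⊆S) (Subset.drop-∷-⊆ S⊆B))
  ∏ℚ-face (outside ∷ A) (outside ∷ B) (inside ∷ S) A⊆S S⊆B with () ← S⊆B here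

  t*p≤p : 0ℚ ℚ.≤ p → t ℚ.* p ℚ.≤ p
  t*p≤p {p} 0≤p = subst (t ℚ.* p ℚ.≤_) (ℚ.*-identityˡ p) (*-monoˡ 0≤p t≤1)

  -- Each departure from the interval costs a factor t: a missing element of A loses K = 1/t, and an
  -- element outside B contributes t. Once one departure is found, `∏ℚ-≤` suffices for the remaining
  -- coordinates, hence the mutual recursion.
  ∏ℚ-off-face : ∀ (A B S : Subset m) → A ⊆ B →
    (A ⊆ S × S ⊆ B) ⊎ ∏ℚ S (weights A B) ℚ.≤ t ℚ.* ∏ℚ A (weights A B)
  ∏ℚ-≤ : ∀ (A B S : Subset m) → A ⊆ B → ∏ℚ S (weights A B) ℚ.≤ ∏ℚ A (weights A B)

  ∏ℚ-off-face [] [] [] _ = inj₁ ((λ ()) , (λ ()))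
  ∏ℚ-off-face (inside ∷ A) (outside ∷ B) S A⊆B with () ← A⊆B here
  ∏ℚ-off-face (inside ∷ A) (inside ∷ B) (outside ∷ S) A⊆B = inj₂ (begin
    ∏ℚ S (weights A B)                     ≤⟨ ∏ℚ-≤ A B S (Subset.drop-∷-⊆ A⊆B) ⟩
    ∏ℚ A (weights A B)                     ≡⟨ ℚ.*-identityˡ _ ⟨
    1ℚ ℚ.* ∏ℚ A (weights A B)              ≡⟨ cong (ℚ._* ∏ℚ A (weights A B)) tK≡1 ⟨
    t ℚ.* K ℚ.* ∏ℚ A (weights A B)         ≡⟨ ℚ.*-assoc t K _ ⟩
    t ℚ.* (K ℚ.* ∏ℚ A (weights A B))       ∎)
    where open ℚ.≤-Reasoning
  ∏ℚ-off-face (inside ∷ A) (inside ∷ B) (inside ∷ S) A⊆B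
    with ∏ℚ-off-face A B S (Subset.drop-∷-⊆ A⊆B)
  ... | inj₁ (A⊆S , S⊆B) = inj₁ (Subset.in⊆in A⊆S , Subset.in⊆in S⊆B)
  ... | inj₂ ≤tW = inj₂ (subst (K ℚ.* ∏ℚ S (weights A B) ℚ.≤_)
    (solve 3 (λ k t w → k :* (t :* w) := t :* (k :* w)) refl K t (∏ℚ A (weights A B)))
    (*-monoʳ (ℚ.<⇒≤ 0<K) ≤tW))
  ∏ℚ-off-face (outside ∷ A) (_ ∷ B) (outside ∷ S) A⊆B
    with ∏ℚ-off-face A B S (Subset.drop-∷-⊆ A⊆B)
  ∏ℚ-off-face (outside ∷ A) (_ ∷ B) (outside ∷ S) A⊆B | inj₁ (A⊆S , S⊆B) = inj₁ (Subset.out⊆ A⊆S , Subset.out⊆ S⊆B)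
  ... | inj₂ ≤tW = inj₂ ≤tW
  ∏ℚ-off-face (outside ∷ A) (inside ∷ B) (inside ∷ S) A⊆B
    with ∏ℚ-off-face A B S (Subset.drop-∷-⊆ A⊆B)
  ... | inj₁ (A⊆S , S⊆B) = inj₁ (Subset.out⊆ A⊆S , Subset.in⊆in S⊆B)
  ... | inj₂ ≤tW = inj₂ (subst (ℚ._≤ _) (sym (ℚ.*-identityˡ _)) ≤tW)
  ∏ℚ-off-face (outside ∷ A) (outside ∷ B) (inside ∷ S) A⊆B =
    inj₂ (*-monoʳ (ℚ.<⇒≤ 0<t) (∏ℚ-≤ A B S (Subset.drop-∷-⊆ A⊆B)))

  ∏ℚ-≤ A B S A⊆B with ∏ℚ-off-face A B S A⊆B
  ... | inj₁ (A⊆S , S⊆B) = ℚ.≤-reflexive (∏ℚ-face A B S A⊆S S⊆B)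
  ... | inj₂ ≤tW = ℚ.≤-trans ≤tW (t*p≤p (ℚ.<⇒≤ (∏ℚ-pos A (weights-pos A B))))

  module _ {n} {A B : Subset n} (A⊆B : A ⊆ B)
    {e f} (e∈B : e Subset.∈ B) (e∉A : e Subset.∉ A) (f∈B : f Subset.∈ B) (f∉A : f Subset.∉ A) (e≢f : e ≢ f)
    where

    Separated : Subset n → Set
    Separated S = e Subset.∈ S × f Subset.∉ S × A ⊆ S × S ⊆ B

    W : ℚ
    W = ∏ℚ A (weights A B)

    0<W : 0ℚ ℚ.< W
    0<W = ∏ℚ-pos A (weights-pos A B)

    -- The term of B in p and that of A in s have size at least a W, and no other term falls below
    -- -M t W. The part r is only bounded by c W, but q gains the factor t, which makes p s win.
    Δ-negative : ∀ (ω : Subset n → ℝ) {a M} k → 0ℚ ℚ.< M →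
      let v = λ S → seq (ω S) k; c = #subsets n ℚ.* M in
      0ℚ ℚ.≤ a ℚ.- c ℚ.* t →
      (∀ S → ∣ v S ∣ ℚ.≤ M) → (∀ S → ℚ.- (M ℚ.* t) ℚ.≤ v S) →
      a ℚ.≤ v A → a ℚ.≤ v B →
      (∀ S → Separated S → v S ℚ.≤ M ℚ.* t) →
      seq (Δ (Z ω) e f (fromℚ ∘ weights A B)) k ℚ.≤ ℚ.- (gap a c t ℚ.* (W ℚ.* W))
    Δ-negative ω {a} {M} k 0<M 0≤b v≤M -δ≤v a≤vA a≤vB v≤δ = subst (ℚ._≤ _)
      (sym (Δ-parts ω e≢f (weights-free e∉A e∈B) (weights-free f∉A f∈B)))
      (Δ-bound {a = a} {c} {t} {W} 0≤t (0≤* 0≤N 0≤M) 0≤W 0≤b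
        (ℚ.≤-trans (∑ℚ-∣∣-≤ (restrict ω (first e f)) first-≤)
          (ℚ.≤-reflexive (solve 4 (λ N M t W → N :* (M :* t :* W) := N :* M :* t :* W) refl N M t W)))
        (ℚ.≤-trans (∑ℚ-∣∣-≤ (restrict ω (second e f)) (restrict-≤ (second e f)))
          (ℚ.≤-reflexive (sym (ℚ.*-assoc N M W))))
        (part-≥ (both e f) B both-B (∏ℚ-face A B B A⊆B id) a≤vB)
        (part-≥ (neither e f) A neither-A refl a≤vA))
      where
      open Evaluation (weights A B) k
      open ℚ.≤-Reasoning
      v : Subset n → ℚ
      v S = seq (ω S) k
      w : Subset n → ℚ
      w S = ∏ℚ S (weights A B)
      N = #subsets n
      c = N ℚ.* M
      δ′ = M ℚ.* t
      0≤M = ℚ.<⇒≤ 0<M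
      0≤t = ℚ.<⇒≤ 0<t
      0≤W = ℚ.<⇒≤ 0<W
      0≤N : 0ℚ ℚ.≤ N
      0≤N = ∑ℚ-nonneg {F = λ (_ : Subset n) → 1ℚ} (λ _ → 0≤1)
      0≤δ : 0ℚ ℚ.≤ δ′
      0≤δ = 0≤* 0≤M 0≤t
      0≤w : ∀ S → 0ℚ ℚ.≤ w S
      0≤w S = ℚ.<⇒≤ (∏ℚ-pos S (weights-pos A B))
      ∣term∣ : ∀ S → ∣ term ω S ∣ ≡ ∣ v S ∣ ℚ.* w S
      ∣term∣ S = trans (ℚ.∣p*q∣≡∣p∣*∣q∣ (v S) (w S)) (cong (∣ v S ∣ ℚ.*_) (ℚ.0≤p⇒∣p∣≡p (0≤w S)))

      restrict-≤ : ∀ χ S → ∣ restrict ω χ S ∣ ℚ.≤ M ℚ.* W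
      restrict-≤ χ S with χ S
      ... | false = 0≤* 0≤M 0≤W
      ... | true  = subst (ℚ._≤ M ℚ.* W) (sym (∣term∣ S))
        (*-mono 0≤M (0≤w S) (v≤M S) (∏ℚ-≤ A B S A⊆B))

      -- The factor t has two sources: the assumed smallness of the coefficient when S lies between
      -- A and B, and the weight of S otherwise.
      first-≤ : ∀ S → ∣ restrict ω (first e f) S ∣ ℚ.≤ δ′ ℚ.* W
      first-≤ S with lookup S e in Se | lookup S f in Sf
      ... | false | _    = 0≤* 0≤δ 0≤W
      ... | true  | true = 0≤* 0≤δ 0≤W
      ... | true  | false with ∏ℚ-off-face A B S A⊆B
      ...   | inj₁ (A⊆S , S⊆B) = subst (ℚ._≤ δ′ ℚ.* W) (sym (∣term∣ S))
        (*-mono 0≤δ (0≤w S)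
          (∣p∣≤ (-δ≤v S) (v≤δ S (lookup⇒[]= e S Se , lookup⇒∉ Sf , A⊆S , S⊆B)))
          (∏ℚ-≤ A B S A⊆B))
      ...   | inj₂ w≤tW = begin
        ∣ term ω S ∣       ≡⟨ ∣term∣ S ⟩
        ∣ v S ∣ ℚ.* w S    ≤⟨ *-mono 0≤M (0≤w S) (v≤M S) w≤tW ⟩
        M ℚ.* (t ℚ.* W)    ≡⟨ ℚ.*-assoc M t W ⟨
        δ′ ℚ.* W           ∎

      restrict-≥ : ∀ χ S → ℚ.- (δ′ ℚ.* W) ℚ.≤ restrict ω χ S
      restrict-≥ χ S with χ S
      ... | false = ℚ.neg-antimono-≤ (0≤* 0≤δ 0≤W)
      ... | true  = begin
        ℚ.- (δ′ ℚ.* W)       ≤⟨ ℚ.neg-antimono-≤ (*-monoʳ 0≤δ (∏ℚ-≤ A B S A⊆B)) ⟩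
        ℚ.- (δ′ ℚ.* w S)     ≡⟨ ℚ.neg-distribˡ-* δ′ (w S) ⟩
        ℚ.- δ′ ℚ.* w S       ≤⟨ *-monoˡ (0≤w S) (-δ≤v S) ⟩
        term ω S             ∎

      part-≥ : ∀ χ S → χ S ≡ true → w S ≡ W → a ℚ.≤ v S →
               (a ℚ.- c ℚ.* t) ℚ.* W ℚ.≤ part ω χ
      part-≥ χ S χS wS≡W a≤vS = begin
        (a ℚ.- c ℚ.* t) ℚ.* W
          ≡⟨ solve 5 (λ a N M t W → (a :- N :* M :* t) :* W := a :* W :- N :* (M :* t :* W)) refl a N M t W ⟩
        a ℚ.* W ℚ.- N ℚ.* (δ′ ℚ.* W)
          ≤⟨ ℚ.+-monoˡ-≤ _ (*-monoˡ 0≤W a≤vS) ⟩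
        v S ℚ.* W ℚ.- N ℚ.* (δ′ ℚ.* W)
          ≡⟨ cong (λ z → v S ℚ.* z ℚ.- N ℚ.* (δ′ ℚ.* W)) wS≡W ⟨
        term ω S ℚ.- N ℚ.* (δ′ ℚ.* W)
          ≡⟨ cong (λ z → (if z then term ω S else 0ℚ) ℚ.- N ℚ.* (δ′ ℚ.* W)) χS ⟨
        restrict ω χ S ℚ.- N ℚ.* (δ′ ℚ.* W)
          ≤⟨ ∑ℚ-lower (restrict ω χ) (0≤* 0≤δ 0≤W) (restrict-≥ χ) S ⟩
        part ω χ ∎

      both-B : both e f B ≡ true
      both-B rewrite []=⇒lookup e∈B | []=⇒lookup f∈B = refl

      neither-A : neither e f A ≡ true
      neither-A rewrite ∉⇒lookup e∉A | ∉⇒lookup f∉A = refl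

    separated? : ∀ S → Dec (Separated S)
    separated? S = (e Subset.∈? S) ×-dec (¬? (f Subset.∈? S) ×-dec ((A Subset.⊆? S) ×-dec (S Subset.⊆? B)))

    ∃-separated : ∀ (ω : Subset n → ℝ) {a M} → (∀ S → 0ℝ ≤ ω S) → IsRayleigh (Z ω) → 0ℚ ℚ.< M →
      let c = #subsets n ℚ.* M in
      0ℚ ℚ.≤ a ℚ.- c ℚ.* t → 0ℚ ℚ.< gap a c t →
      Eventually (λ k → ∀ S → ∣ seq (ω S) k ∣ ℚ.≤ M) →
      Eventually (λ k → a ℚ.≤ seq (ω A) k) → Eventually (λ k → a ℚ.≤ seq (ω B) k) →
      ∃ λ S → 0ℝ < ω S × Separated S
    ∃-separated ω {a} {M} 0≤ω rayleigh 0<M 0≤a-ct 0<gap ω≤M a≤ωA a≤ωB =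
      -- The threshold M t gives separated sets the same bound M t W that the sets off the interval
      -- already satisfy.
      conclude (∃⊎∀ λ S → guard (separated? S) (0<⊎eventually-≤ (ω S) (M ℚ.* t) 0<Mt))
      where
      open ℚ.≤-Reasoning
      0<Mt : 0ℚ ℚ.< M ℚ.* t
      0<Mt = 0<* 0<M 0<t
      G = gap a (#subsets n ℚ.* M) t ℚ.* (W ℚ.* W)
      0<G : 0ℚ ℚ.< G
      0<G = 0<* 0<gap (0<* 0<W 0<W)

      Small : Subset n → ℕ → Set
      Small S k = Separated S → seq (ω S) k ℚ.≤ M ℚ.* t

      conclude : (∃ λ S → 0ℝ < ω S × Separated S) ⊎ (∀ S → Eventually (Small S)) →
                 ∃ λ S → 0ℝ < ω S × Separated S
      conclude (inj₁ found) = found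
      conclude (inj₂ small) = ⊥-elim
        (rayleigh e f e≢f (fromℚ ∘ weights A B) (fromℚ-pos ∘ weights-pos A B)
          -- Eventually Δ ≤ -G; giving away only half of G keeps the inequality strict.
          (½ ℚ.* G , 0<½* 0<G , proj₁ facts , λ k ≤k → negative k (proj₂ facts k ≤k)))
        where
        Facts : ℕ → Set
        Facts k = ((∀ S → ∣ seq (ω S) k ∣ ℚ.≤ M) × (∀ S → ℚ.- (M ℚ.* t) ℚ.≤ seq (ω S) k)) ×
          (a ℚ.≤ seq (ω A) k × a ℚ.≤ seq (ω B) k) × (∀ S → Small S k)
        facts : Eventually Facts
        facts = eventually-×
          (eventually-× ω≤M (eventually-∀ (λ S → 0≤⇒eventually {ω S} (0≤ω S) (M ℚ.* t) 0<Mt)))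
          (eventually-× (eventually-× a≤ωA a≤ωB) (eventually-∀ small))
        negative : ∀ k → Facts k →
          seq (Δ (Z ω) e f (fromℚ ∘ weights A B)) k ℚ.+ ½ ℚ.* G ℚ.< 0ℚ
        negative k ((≤M , -δ≤) , (a≤ , b≤) , ≤δ) = begin-strict
          seq (Δ (Z ω) e f (fromℚ ∘ weights A B)) k ℚ.+ ½ ℚ.* G
            ≤⟨ ℚ.+-monoˡ-≤ (½ ℚ.* G) (Δ-negative ω k 0<M 0≤a-ct ≤M -δ≤ a≤ b≤ ≤δ) ⟩
          ℚ.- G ℚ.+ ½ ℚ.* G
            ≡⟨ solve 1 (λ g → :- g :+ con ½ :* g := :- (con ½ :* g)) refl G ⟩
          ℚ.- (½ ℚ.* G)
            <⟨ ℚ.neg-antimono-< (0<½* 0<G) ⟩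
          0ℚ ∎

-- From the Rayleigh condition to the full power set.

-- The order of choices matters: the lower bounds a, b and the upper bound M depend on ω alone, t is
-- then chosen from them, and K is its inverse. The minimum of a and b serves both ends of the
-- interval.
support-separating : ∀ (ω : Subset n → ℝ) → (∀ S → 0ℝ ≤ ω S) → IsRayleigh (Z ω) →
                     Separating (λ S → 0ℝ < ω S)
support-separating {n} ω 0≤ω rayleigh {A} {B} {e} {f} A⊆B 0<ωA 0<ωB e∈B e∉A f∈B f∉A e≢f =
  with-bounds (0<⇒eventually {ω A} 0<ωA) (0<⇒eventually {ω B} 0<ωB) (uniformly-bounded ω)
  where
  Goal : Set
  Goal = ∃ λ S → 0ℝ < ω S × e Subset.∈ S × f Subset.∉ S × A ⊆ S × S ⊆ B

  with-bounds :
    (∃ λ a → 0ℚ ℚ.< a × Eventually (λ k → a ℚ.≤ seq (ω A) k)) →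
    (∃ λ b → 0ℚ ℚ.< b × Eventually (λ k → b ℚ.≤ seq (ω B) k)) →
    (∃ λ M → 0ℚ ℚ.< M × Eventually (λ k → ∀ S → ∣ seq (ω S) k ∣ ℚ.≤ M)) → Goal
  with-bounds (a , 0<a , a≤ωA) (b , 0<b , b≤ωB) (M , 0<M , ω≤M) =
    with-scale (small-scale (0<⊓ 0<a 0<b)
      (0≤* (∑ℚ-nonneg {F = λ (_ : Subset n) → 1ℚ} (λ _ → 0≤1)) (ℚ.<⇒≤ 0<M)))
    where
    c = #subsets n ℚ.* M
    with-scale : (∃ λ t → 0ℚ ℚ.< t × t ℚ.≤ 1ℚ × 0ℚ ℚ.≤ a ℚ.⊓ b ℚ.- c ℚ.* t × 0ℚ ℚ.< gap (a ℚ.⊓ b) c t) → Goal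
    with-scale (t , 0<t , t≤1 , 0≤a-ct , 0<gap) = with-inverse (divide-by 0<t (ℚ.positive⁻¹ 1ℚ))
      where
      with-inverse : (∃ λ K → 0ℚ ℚ.< K × t ℚ.* K ≡ 1ℚ) → Goal
      with-inverse (K , 0<K , tK≡1) =
        Face.∃-separated 0<t t≤1 0<K tK≡1 A⊆B e∈B e∉A f∈B f∉A e≢f ω 0≤ω rayleigh 0<M 0≤a-ct 0<gap ω≤M
          (eventually-map (ℚ.≤-trans (ℚ.p⊓q≤p a b)) a≤ωA)
          (eventually-map (ℚ.≤-trans (ℚ.p⊓q≤q a b)) b≤ωB)

theorem4p2 : ∀ (n : ℕ) (Q : SetSystem n) → IsWeaklyRayleigh Q →
    ⊥ ∈ Q → ⊤ ∈ Q → Q ≐ U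
theorem4p2 n Q wr ⊥∈Q ⊤∈Q = (λ _ → tt) , λ {S} _ →
  -- Every set lies in the interval from ∅ to E.
  proj₁ support (interval (support-separating ω ω-nonneg rayleigh) ⊥ ⊤ (⊂-wellFounded _) Subset.⊥⊆
    (proj₂ support ⊥∈Q) (proj₂ support ⊤∈Q) S Subset.⊥⊆ Subset.⊆⊤)
  where open IsWeaklyRayleigh wr
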